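{- Let $G$ be a connected cubic ($3$-regular) graph. The following are equivalent: (1) $G$ is localizable; (2) every vertex of $G$ is contained in a strong clique; (3) $G$ is isomorphic to one of $K_{3,3}$, $K_4$, $\overline{C_6}$ (the complement of the $6$-cycle), or $F_n$ for some integer $n\ge 2$. In particular, localizable cubic graphs can be recognized in polynomial time.
   Context: A clique is strong if it intersects every maximal independent set. A graph is localizable if its vertex set admits a partition into strong cliques. For $n\ge 2$, the graph $F_n$ is defined as follows: for each $i\in\{1,\dots,n\}$ take six vertices $x_i,y_i,z_i,x'_i,y'_i,z'_i$ with edges $x_iy_i, x_iz_i, y_iz_i$ (a triangle), $x'_iy'_i, x'_iz'_i, y'_iz'_i$ (a triangle), and $y_iy'_i$, $z_iz'_i$ (so this $6$-vertex block is two triangles joined by two disjoint edges, with $x_i,x'_i$ of degree $2$ in the block); then add the edges $x_ix'_{i+1}$ for $i=1,\dots,n-1$ and the edge $x_nx'_1$. (For $n=2$ the added edges are $x_1x'_2$ and $x_2x'_1$.) -}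

module Defs where

open import Data.Bool using (Bool; true; false; _∧_; _∨_; not; if_then_else_)
open import Data.Bool.Properties using (∨-comm; ∧-zeroʳ)
open import Data.Fin using (Fin; toℕ; fromℕ<)
import Data.Fin as Fin
import Data.Fin.Properties as Fin
open import Data.Fin.Subset using (Subset; _∈_; _⊆_; _∩_; ∣_∣; Nonempty)
open import Data.Nat using (ℕ; suc; _+_; _*_; _^_; _∸_; _≤_; _≡ᵇ_; _<?_)
import Data.Nat as ℕ
open import Data.Product using (∃; ∃-syntax; ∃!; _×_; _,_)
open import Data.Sum using (_⊎_; inj₁; inj₂)
open import Data.Vec using (tabulate)
open import Function.Bundles using (_↔_; _⇔_; Inverse)
open import Relation.Binary.Construct.Closure.ReflexiveTransitive using (Star)
open import Relation.Binary.Definitions using (DecidableEquality)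
open import Relation.Binary.PropositionalEquality
  using (_≡_; _≢_; refl; sym; cong; cong₂)
open import Relation.Nullary using (¬_; does; yes; no)
open import Relation.Nullary.Decidable using (dec-true)

------------------------------------------------------------------------
-- Simple graphs

record Graph (V : Set) : Set where
  field
    adj        : V → V → Bool
    adj-sym    : ∀ u v → adj u v ≡ adj v u
    adj-irrefl : ∀ v → adj v v ≡ false

  Adj : V → V → Set
  Adj u v = adj u v ≡ true

record _≅_ {V W : Set} (G : Graph V) (H : Graph W) : Set where
  field
    bijection : V ↔ W
    preserves : ∀ u v →
      Graph.adj G u v ≡ Graph.adj H (Inverse.to bijection u) (Inverse.to bijection v)

infix 4 _≅_

-- The order n of G is positive by convention: the empty graph is not connected.
Connected : ∀ {n} → Graph (Fin n) → Set
Connected {n} G = 1 ≤ n × (∀ u v → Star (Graph.Adj G) u v)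

module _ {n} (G : Graph (Fin n)) where
  open Graph G

  neighbourhood : Fin n → Subset n
  neighbourhood v = tabulate (adj v)

  degree : Fin n → ℕ
  degree v = ∣ neighbourhood v ∣

  Cubic : Set
  Cubic = ∀ v → degree v ≡ 3

  Clique : Subset n → Set
  Clique C = ∀ {u v} → u ∈ C → v ∈ C → u ≢ v → Adj u v

  Independent : Subset n → Set
  Independent I = ∀ {u v} → u ∈ I → v ∈ I → ¬ Adj u v

  MaximalIndependent : Subset n → Set
  MaximalIndependent I =
    Independent I × (∀ J → Independent J → I ⊆ J → J ⊆ I)

  StrongClique : Subset n → Set
  StrongClique C =
    Clique C × (∀ I → MaximalIndependent I → Nonempty (C ∩ I))

  EveryVertexInStrongClique : Set
  EveryVertexInStrongClique = ∀ v → ∃[ C ] (StrongClique C × v ∈ C)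

IsPartition : ∀ {n k} → (Fin k → Subset n) → Set
IsPartition P =
  (∀ i → Nonempty (P i)) × (∀ v → ∃! _≡_ (λ i → v ∈ P i))

Localizable : ∀ {n} → Graph (Fin n) → Set
Localizable {n} G =
  ∃[ k ] ∃[ P ] (IsPartition {n} {k} P × (∀ i → StrongClique G (P i)))

------------------------------------------------------------------------
-- Particular graphs

fromEdges : ∀ {V : Set} (e : V → V → Bool) → (∀ v → e v v ≡ false) → Graph V
fromEdges e e-irrefl = record
  { adj        = λ u v → e u v ∨ e v u
  ; adj-sym    = λ u v → ∨-comm (e u v) (e v u)
  ; adj-irrefl = λ v → cong₂ _∨_ (e-irrefl v) (e-irrefl v)
  }

module _ {V : Set} (_≟_ : DecidableEquality V) where

  distinct : V → V → Bool
  distinct u v = not (does (u ≟ v))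

  distinct-sym : ∀ u v → distinct u v ≡ distinct v u
  distinct-sym u v with u ≟ v | v ≟ u
  ... | yes _   | yes _   = refl
  ... | yes refl | no v≢u with () ← v≢u refl
  ... | no u≢v  | yes refl with () ← u≢v refl
  ... | no _    | no _    = refl

  distinct-irrefl : ∀ v → distinct v v ≡ false
  distinct-irrefl v = cong not (dec-true (v ≟ v) refl)

  complete : Graph V
  complete = record
    { adj        = distinct
    ; adj-sym    = distinct-sym
    ; adj-irrefl = distinct-irrefl
    }

  complement : Graph V → Graph V
  complement G = record
    { adj        = λ u v → distinct u v ∧ not (adj u v)
    ; adj-sym    = λ u v → cong₂ _∧_ (distinct-sym u v) (cong not (adj-sym u v))
    ; adj-irrefl = λ v → cong (_∧ not (adj v v)) (distinct-irrefl v)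
    }
    where open Graph G

K₄ : Graph (Fin 4)
K₄ = complete Fin._≟_

K₃,₃ : Graph (Fin 3 ⊎ Fin 3)
K₃,₃ = fromEdges e λ { (inj₁ _) → refl ; (inj₂ _) → refl }
  where
  e : Fin 3 ⊎ Fin 3 → Fin 3 ⊎ Fin 3 → Bool
  e (inj₁ _) (inj₂ _) = true
  e _        _        = false

-- j follows i in the cyclic order 0, 1, …, n − 1, 0.
isNext : ∀ {n} → Fin n → Fin n → Bool
isNext {n} i j =
  (toℕ j ≡ᵇ suc (toℕ i)) ∨ ((suc (toℕ i) ≡ᵇ n) ∧ (toℕ j ≡ᵇ 0))

C₆ : Graph (Fin 6)
C₆ = fromEdges isNext λ
  { Fin.zero → refl
  ; (Fin.suc Fin.zero) → refl
  ; (Fin.suc (Fin.suc Fin.zero)) → refl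
  ; (Fin.suc (Fin.suc (Fin.suc Fin.zero))) → refl
  ; (Fin.suc (Fin.suc (Fin.suc (Fin.suc Fin.zero)))) → refl
  ; (Fin.suc (Fin.suc (Fin.suc (Fin.suc (Fin.suc Fin.zero))))) → refl
  }

C₆-complement : Graph (Fin 6)
C₆-complement = complement Fin._≟_ C₆

data Label : Set where
  𝐱 𝐲 𝐳 𝐱′ 𝐲′ 𝐳′ : Label

-- Each edge of the six-vertex block, in one orientation.
blockEdge : Label → Label → Bool
blockEdge 𝐱  𝐲  = true
blockEdge 𝐱  𝐳  = true
blockEdge 𝐲  𝐳  = true
blockEdge 𝐱′ 𝐲′ = true
blockEdge 𝐱′ 𝐳′ = true
blockEdge 𝐲′ 𝐳′ = true
blockEdge 𝐲  𝐲′ = true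
blockEdge 𝐳  𝐳′ = true
blockEdge _  _  = false

linkEdge : Label → Label → Bool
linkEdge 𝐱 𝐱′ = true
linkEdge _ _  = false

-- The vertex (i , 𝐱) is x_{i+1}, since Fin n counts from 0. The definition makes
-- sense for all n, but F n is the graph intended only for n ≥ 2.
F : ∀ n → Graph (Fin n × Label)
F n = fromEdges e e-irrefl
  where
  e : Fin n × Label → Fin n × Label → Bool
  e (i , a) (j , b) = (does (i Fin.≟ j) ∧ blockEdge a b) ∨ (isNext i j ∧ linkEdge a b)

  ∧-false : ∀ p q → (p ∧ false) ∨ (q ∧ false) ≡ false
  ∧-false p q = cong₂ _∨_ (∧-zeroʳ p) (∧-zeroʳ q)

  e-irrefl : ∀ v → e v v ≡ false
  e-irrefl (i , 𝐱)  = ∧-false (does (i Fin.≟ i)) (isNext i i)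
  e-irrefl (i , 𝐲)  = ∧-false (does (i Fin.≟ i)) (isNext i i)
  e-irrefl (i , 𝐳)  = ∧-false (does (i Fin.≟ i)) (isNext i i)
  e-irrefl (i , 𝐱′) = ∧-false (does (i Fin.≟ i)) (isNext i i)
  e-irrefl (i , 𝐲′) = ∧-false (does (i Fin.≟ i)) (isNext i i)
  e-irrefl (i , 𝐳′) = ∧-false (does (i Fin.≟ i)) (isNext i i)

------------------------------------------------------------------------
-- Polynomial-time recognition
--
-- The machine is a unit-cost random access machine in the style of Cook and
-- Reckhow, programmed with structured control flow, whose input graph is given by
-- its adjacency matrix. Addition and truncated subtraction are the only arithmetic
-- (no multiplication), so t steps produce numbers of O(t + log n) bits and the
-- model is polynomially equivalent to Turing machines.

Address : Set
Address = ℕ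

data Instruction : Set where
  const : (a : Address) (k : ℕ) → Instruction      -- M[a] := k
  add   : (a b c : Address) → Instruction          -- M[a] := M[b] + M[c]
  sub   : (a b c : Address) → Instruction          -- M[a] := M[b] ∸ M[c]
  load  : (a b : Address) → Instruction            -- M[a] := M[M[b]]
  store : (a b : Address) → Instruction            -- M[M[a]] := M[b]
  query : (a b c : Address) → Instruction          -- M[a] := 1 if vertices M[b] and
                                                   -- M[c] are adjacent, 0 otherwise

-- Conditionals and loops branch on M[a] ≢ 0.
data Program : Set where
  instr    : Instruction → Program
  _⨾_      : Program → Program → Program
  ifNZ     : (a : Address) (p q : Program) → Program
  whileNZ  : (a : Address) (p : Program) → Program

infixr 5 _⨾_

Memory : Set
Memory = Address → ℕ

_[_↦_] : Memory → Address → ℕ → Memory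
(M [ a ↦ k ]) b = if does (b ℕ.≟ a) then k else M b

module _ {n} (G : Graph (Fin n)) where

  -- Indices that are not vertices are adjacent to nothing.
  matrixEntry : ℕ → ℕ → ℕ
  matrixEntry i j with i <? n | j <? n
  ... | yes i<n | yes j<n = if Graph.adj G (fromℕ< i<n) (fromℕ< j<n) then 1 else 0
  ... | _       | _       = 0

  execute : Instruction → Memory → Memory
  execute (const a k)   M = M [ a ↦ k ]
  execute (add a b c)   M = M [ a ↦ M b + M c ]
  execute (sub a b c)   M = M [ a ↦ M b ∸ M c ]
  execute (load a b)    M = M [ a ↦ M (M b) ]
  execute (store a b)   M = M [ M a ↦ M b ]
  execute (query a b c) M = M [ a ↦ matrixEntry (M b) (M c) ]

  -- Runs p M t M′: from memory M, p halts with memory M′ after exactly t steps.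
  data Runs : Program → Memory → ℕ → Memory → Set where
    instr      : ∀ {i M} → Runs (instr i) M 1 (execute i M)
    seq        : ∀ {p q M M′ M″ s t} →
                 Runs p M s M′ → Runs q M′ t M″ → Runs (p ⨾ q) M (s + t) M″
    if-then    : ∀ {a p q M M′ t} → M a ≢ 0 →
                 Runs p M t M′ → Runs (ifNZ a p q) M (suc t) M′
    if-else    : ∀ {a p q M M′ t} → M a ≡ 0 →
                 Runs q M t M′ → Runs (ifNZ a p q) M (suc t) M′
    while-stop : ∀ {a p M} → M a ≡ 0 → Runs (whileNZ a p) M 1 M
    while-step : ∀ {a p M M′ M″ s t} → M a ≢ 0 →
                 Runs p M s M′ → Runs (whileNZ a p) M′ t M″ →
                 Runs (whileNZ a p) M (suc (s + t)) M″

-- Initially cell 0 holds the number of vertices and every other cell holds 0.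
initial : ℕ → Memory
initial n = (λ _ → 0) [ 0 ↦ n ]

-- A run accepts when it halts with 1 in cell 0. One program works for all n, and
-- it must halt within the time bound whether or not it accepts.
RecognizableInPolynomialTime : (∀ {n} → Graph (Fin n) → Set) → Set
RecognizableInPolynomialTime P =
  ∃[ p ] ∃[ c ] ∃[ d ] ∀ {n} (G : Graph (Fin n)) →
    ∃[ t ] ∃[ M ] (Runs G p (initial n) t M × t ≤ c * n ^ d + c × (M 0 ≡ 1 ⇔ P G))

{-# OPTIONS --safe #-}
-- A strong clique of a cubic graph is recognised locally: a maximal independent set
-- misses a clique C exactly when it contains a neighbour outside C of every vertex of C,
-- so C is strong iff no choice of such neighbours is independent. Hence a strong clique
-- is an edge of a K₃,₃, or a K₄, or a triangle two of whose outer neighbours are adjacent.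
-- Two triangles sharing an edge would leave the vertex at the tip of that diamond in no
-- strong clique. So, apart from K₃,₃ and K₄, the triangles partition the vertices and pair
-- up into six-vertex blocks, and a connected graph arranges its blocks in a cycle.
--
-- The input of the recognition problem may be disconnected, so (2) ⇒ (1) is proved without
-- the classification: a family of disjoint strong cliques extends greedily, because a strong
-- triangle or K₄ meets no other strong clique, and in a K₃,₃ every matching extends to a
-- perfect one.
--
-- Being cubic and locally strong is a first-order property of the graph, and the
-- evaluation of a fixed first-order formula by nested loops takes polynomial time.
module Submission where

open import Data.Bool using (Bool; T; true; false; _∨_; _∧_; if_then_else_)
open import Data.Bool.Properties using (∨-zeroʳ; T-≡) renaming (_≟_ to _≟ᵇ_)
open import Data.Empty using (⊥; ⊥-elim)
open import Data.Fin using (Fin; zero; suc; toℕ; fromℕ; fromℕ<; inject₁)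
open import Data.Fin.Patterns
open import Data.Fin.Properties
  using (all?; any?; toℕ<n; toℕ-fromℕ; fromℕ<-toℕ; toℕ-fromℕ<; toℕ-inject₁; toℕ-injective;
         injective⇒≤)
  renaming (_≟_ to _≟ᶠ_)
open import Data.Fin.Relation.Unary.Top using (view; ‵fromℕ; ‵inject₁)
open import Data.Fin.Subset
  using (Subset; inside; outside; _∈_; _∉_; _⊆_; _∪_; _∩_; _-_; ⁅_⁆; ∣_∣; ⋃; Nonempty)
open import Data.Fin.Subset.Properties
  using (_∈?_; nonempty?; Empty-unique; ∣⊥∣≡0; p─⊥≡p; p─q⊆p; x∈⁅x⁆; x∈⁅y⁆⇒x≡y; ∉⊥; p⊆p∪q;
         x∈p∪q⁺; x∈p∪q⁻; x∈p∩q⁺; x∈p∩q⁻; x∈p∧x≢y⇒x∈p-y)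
open import Data.List using (List; []; _∷_; map)
open import Data.List.Membership.Propositional using () renaming (_∈_ to _∈ₗ_)
open import Data.List.Relation.Unary.All as All using ([]; _∷_)
open import Data.List.Relation.Unary.AllPairs using (AllPairs; []; _∷_)
open import Data.List.Relation.Unary.Any using (here; there)
open import Data.Nat
  using (ℕ; zero; suc; _+_; _*_; _∸_; _^_; _≤_; _<_; z≤n; s≤s; s≤s⁻¹; _≡ᵇ_; _<?_)
  renaming (_≟_ to _≟ⁿ_)
open import Data.Nat.Properties hiding (_≟_; _<?_)
open import Data.Product using (Σ-syntax; ∃-syntax; _×_; _,_; proj₁; proj₂)
open import Data.Sum using (_⊎_; inj₁; inj₂; [_,_]′; swap)
open import Data.Sum.Properties using (inj₁-injective; inj₂-injective)
open import Data.Vec using (Vec; []; _∷_; here; there; lookup)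
open import Data.Vec.Functional using () renaming (_∷_ to _◂_)
open import Data.Vec.Properties using (lookup∘tabulate; []=⇒lookup; lookup⇒[]=)
open import Function using (_∘_; id)
open import Function.Bundles using (_⇔_; mk⇔; mk↔ₛ′; Inverse; Equivalence)
open import Relation.Binary.Construct.Closure.ReflexiveTransitive using (Star; ε; _◅_)
open import Relation.Binary.Definitions using (Symmetric)
open import Relation.Binary.PropositionalEquality
open import Relation.Nullary using (¬_; Dec; yes; no; does; contradiction)
open import Relation.Nullary.Decidable
  using (dec-true; dec-false; toWitness; ¬?; _×-dec_; _⊎-dec_; decidable-stable)
open import Defs

-- Greedy saturation, cardinalities of subsets

-- Strength quantifies over all maximal independent sets, of which there may be exponentially many
-- and which do not travel along maps of graphs. `LocallyStrong` replaces it by a positive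
-- existential condition on at most six vertices; being positive, it passes along every injective
-- homomorphism, so it only has to be checked on the listed graphs themselves. Conversely, an
-- injective homomorphism from a listed graph is enough to identify a connected cubic graph: a
-- three-regular source uses up all edges at its image, so the image cannot be left. No non-edge
-- ever has to be tracked. The complement of `C₆` is `F 1`, a single block whose `𝐱` and `𝐱′` are
-- joined. The cyclic arrangement therefore gives one family starting at one block, and the prism is
-- split off only in the final list.

-- Coverage only grows, so treating each vertex once suffices. The state `S` may carry invariants:
-- it is an independent set in one use and a packing by strong cliques in the other.
saturate : ∀ {n} {S : Set} (Q : S → Fin n → Set) →
  (∀ s v → Σ[ s′ ∈ S ] Q s′ v × (∀ u → Q s u → Q s′ u)) →
  S → Σ[ s ∈ S ] (∀ v → Q s v)
saturate {zero}  Q step s = s , λ ()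
saturate {suc n} Q step s
  with saturate (λ s v → Q s (suc v))
         (λ s v → let (s′ , q , mono) = step s (suc v) in s′ , q , λ u → mono (suc u)) s
... | s₁ , covered with step s₁ zero
... | s₂ , q , mono = s₂ , λ { zero → q ; (suc v) → mono (suc v) (covered v) }

∣p-x∣ : ∀ {n} {p : Subset n} {x} → x ∈ p → ∣ p ∣ ≡ suc ∣ p - x ∣
∣p-x∣ {p = inside ∷ p}  here      = cong (suc ∘ ∣_∣) (sym (p─⊥≡p p))
∣p-x∣ {p = inside ∷ p}  (there i) = cong suc (∣p-x∣ i)
∣p-x∣ {p = outside ∷ p} (there i) = ∣p-x∣ i

x∉p-x : ∀ {n} (p : Subset n) x → x ∉ p - x
x∉p-x (_ ∷ p) (suc x) (there i) = x∉p-x p x i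

x∈p-y⇒x≢y : ∀ {n} {p : Subset n} {x y} → x ∈ p - y → x ≢ y
x∈p-y⇒x≢y {p = p} {x} i refl = x∉p-x p x i

∣p∣≡suc⇒Nonempty : ∀ {n k} (p : Subset n) → ∣ p ∣ ≡ suc k → Nonempty p
∣p∣≡suc⇒Nonempty {n} p eq with nonempty? p
... | yes ne = ne
... | no e with trans (sym eq) (trans (cong ∣_∣ (Empty-unique e)) (∣⊥∣≡0 n))
... | ()

-- Local shapes of a strong clique

module _ {V : Set} (G : Graph V) where
  open Graph G

  -- That there is no fourth neighbour is left to `Cubic`; without it the statement is positive and
  -- survives injective homomorphisms.
  record ThreeNeighbours (v a b c : V) : Set where
    constructor threeNeighbours
    field
      a≢b : a ≢ b
      a≢c : a ≢ c
      b≢c : b ≢ c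
      v~a : Adj v a
      v~b : Adj v b
      v~c : Adj v c

  -- In a cubic graph this is a `K₃,₃` with sides `v`, `b₁`, `b₂` and `u`, `a₁`, `a₂`.
  record StrongEdge (v u : V) : Set where
    constructor strongEdge
    field
      {a₁ a₂ b₁ b₂} : V
      around-v : ThreeNeighbours v u a₁ a₂
      around-u : ThreeNeighbours u v b₁ b₂
      a₁~b₁ : Adj a₁ b₁
      a₁~b₂ : Adj a₁ b₂
      a₂~b₁ : Adj a₂ b₁
      a₂~b₂ : Adj a₂ b₂

  -- The outer neighbours `p`, `q`, `r` may coincide here. In a cubic graph that is locally strong
  -- everywhere, `noDiamond` excludes this later.
  record StrongTriangle (v b c : V) : Set where
    constructor strongTriangle
    field
      {p q r} : V
      around-v : ThreeNeighbours v b c p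
      around-b : ThreeNeighbours b v c q
      around-c : ThreeNeighbours c v b r
      linked   : Adj p q ⊎ Adj p r ⊎ Adj q r

  record Tetrahedron (v a b c : V) : Set where
    constructor tetrahedron
    field
      around-v : ThreeNeighbours v a b c
      a~b : Adj a b
      a~c : Adj a c
      b~c : Adj b c

  LocallyStrong : V → Set
  LocallyStrong v =
    (∃[ u ] StrongEdge v u) ⊎
    (∃[ b ] ∃[ c ] StrongTriangle v b c) ⊎
    (∃[ a ] ∃[ b ] ∃[ c ] Tetrahedron v a b c)

module _ {V : Set} {G : Graph V} where
  open Graph G

  ~-sym : ∀ {u v} → Adj u v → Adj v u
  ~-sym {u} {v} e = trans (adj-sym v u) e

  ~-irrefl : ∀ {v} → ¬ Adj v v
  ~-irrefl {v} e with trans (sym e) (adj-irrefl v)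
  ... | ()

  ~⇒≢ : ∀ {u v} → Adj u v → u ≢ v
  ~⇒≢ e refl = ~-irrefl e

  swap₁₂ : ∀ {v a b c} → ThreeNeighbours G v a b c → ThreeNeighbours G v b a c
  swap₁₂ (threeNeighbours ab ac bc a b c) = threeNeighbours (≢-sym ab) bc ac b a c

  swap₂₃ : ∀ {v a b c} → ThreeNeighbours G v a b c → ThreeNeighbours G v a c b
  swap₂₃ (threeNeighbours ab ac bc a b c) = threeNeighbours ac ab (≢-sym bc) a c b

  swapTriangle : ∀ {v b c} → StrongTriangle G v b c → StrongTriangle G v c b
  swapTriangle (strongTriangle tv tb tc linked) = strongTriangle (swap₁₂ tv) tc tb
    ([ inj₂ ∘ inj₁ , [ inj₁ , inj₂ ∘ inj₂ ∘ ~-sym ]′ ]′ linked)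

  rotateTriangle : ∀ {v b c} → StrongTriangle G v b c → StrongTriangle G b v c
  rotateTriangle (strongTriangle tv tb tc linked) = strongTriangle tb tv (swap₁₂ tc)
    ([ inj₁ ∘ ~-sym , [ inj₂ ∘ inj₂ , inj₂ ∘ inj₁ ]′ ]′ linked)

-- Degrees in terms of named neighbours

module _ {n : ℕ} (G : Graph (Fin n)) where
  open Graph G
  private N = neighbourhood G

  ∈neighbourhood⁺ : ∀ {v w} → Adj v w → w ∈ N v
  ∈neighbourhood⁺ {v} {w} e = lookup⇒[]= w _ (trans (lookup∘tabulate (adj v) w) e)

  ∈neighbourhood⁻ : ∀ {v w} → w ∈ N v → Adj v w
  ∈neighbourhood⁻ {v} {w} i = trans (sym (lookup∘tabulate (adj v) w)) ([]=⇒lookup i)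

  _~?_ : ∀ u v → Dec (Adj u v)
  u ~? v = adj u v ≟ᵇ true

  module _ {v a b c : Fin n} (t : ThreeNeighbours G v a b c) where
    open ThreeNeighbours t

    degree-minus-three : degree G v ≡ 3 + ∣ N v - a - b - c ∣
    degree-minus-three = trans (∣p-x∣ (∈neighbourhood⁺ v~a))
      (cong suc (trans (∣p-x∣ b∈) (cong suc (∣p-x∣ c∈))))
      where
      b∈ : b ∈ N v - a
      b∈ = x∈p∧x≢y⇒x∈p-y (∈neighbourhood⁺ v~b) (≢-sym a≢b)
      c∈ : c ∈ N v - a - b
      c∈ = x∈p∧x≢y⇒x∈p-y (x∈p∧x≢y⇒x∈p-y (∈neighbourhood⁺ v~c) (≢-sym a≢c)) (≢-sym b≢c)

    Complete : Set
    Complete = ∀ w → Adj v w → w ≡ a ⊎ w ≡ b ⊎ w ≡ c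

    degree≡3⇒complete : degree G v ≡ 3 → Complete
    degree≡3⇒complete d w e with w ≟ᶠ a | w ≟ᶠ b | w ≟ᶠ c
    ... | yes w≡a | _ | _ = inj₁ w≡a
    ... | no _ | yes w≡b | _ = inj₂ (inj₁ w≡b)
    ... | no _ | no _ | yes w≡c = inj₂ (inj₂ w≡c)
    ... | no w≢a | no w≢b | no w≢c
      with trans (sym d) (trans degree-minus-three (cong (3 +_) (∣p-x∣ w∈)))
      where
      w∈ : w ∈ N v - a - b - c
      w∈ = x∈p∧x≢y⇒x∈p-y (x∈p∧x≢y⇒x∈p-y (x∈p∧x≢y⇒x∈p-y (∈neighbourhood⁺ e) w≢a) w≢b) w≢c
    ... | ()

    complete⇒degree≡3 : Complete → degree G v ≡ 3
    complete⇒degree≡3 all = trans degree-minus-three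
      (cong (3 +_) (trans (cong ∣_∣ (Empty-unique empty)) (∣⊥∣≡0 n)))
      where
      empty : ¬ Nonempty (N v - a - b - c)
      empty (w , w∈) with all w (∈neighbourhood⁻ (p─q⊆p _ ⁅ a ⁆ (p─q⊆p _ ⁅ b ⁆ (p─q⊆p _ ⁅ c ⁆ w∈))))
      ... | inj₁ refl = x∈p-y⇒x≢y (p─q⊆p _ ⁅ b ⁆ (p─q⊆p _ ⁅ c ⁆ w∈)) refl
      ... | inj₂ (inj₁ refl) = x∈p-y⇒x≢y (p─q⊆p _ ⁅ c ⁆ w∈) refl
      ... | inj₂ (inj₂ refl) = x∈p-y⇒x≢y w∈ refl

module CubicGraph {n : ℕ} (G : Graph (Fin n)) (cubic : Cubic G) where
  open Graph G
  private N = neighbourhood G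

  neighbours : ∀ {v a b c} → ThreeNeighbours G v a b c → ∀ {w} → Adj v w → w ≡ a ⊎ w ≡ b ⊎ w ≡ c
  neighbours {v} t {w} = degree≡3⇒complete G t (cubic v) w

  thirdNeighbour : ∀ {v a b} → Adj v a → Adj v b → a ≢ b → ∃[ c ] ThreeNeighbours G v a b c
  thirdNeighbour {v} {a} {b} v~a v~b a≢b
    with ∣p∣≡suc⇒Nonempty (N v - a - b)
      (suc-injective (suc-injective (trans (sym (trans (∣p-x∣ (∈neighbourhood⁺ G v~a)) (cong suc
        (∣p-x∣ (x∈p∧x≢y⇒x∈p-y (∈neighbourhood⁺ G v~b) (≢-sym a≢b)))))) (cubic v))))
  ... | c , c∈ = c , threeNeighbours a≢b (≢-sym (x∈p-y⇒x≢y (p─q⊆p _ ⁅ b ⁆ c∈))) (≢-sym (x∈p-y⇒x≢y c∈))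
    v~a v~b (∈neighbourhood⁻ G (p─q⊆p _ ⁅ a ⁆ (p─q⊆p _ ⁅ b ⁆ c∈)))

  otherNeighbours : ∀ {v a} → Adj v a → ∃[ b ] ∃[ c ] ThreeNeighbours G v a b c
  otherNeighbours {v} {a} v~a
    with ∣p∣≡suc⇒Nonempty (N v - a) (suc-injective (trans (sym (∣p-x∣ (∈neighbourhood⁺ G v~a))) (cubic v)))
  ... | b , b∈ = b , thirdNeighbour v~a (∈neighbourhood⁻ G (p─q⊆p _ ⁅ a ⁆ b∈)) (≢-sym (x∈p-y⇒x≢y b∈))

  allNeighbours : ∀ v → ∃[ a ] ∃[ b ] ∃[ c ] ThreeNeighbours G v a b c
  allNeighbours v with ∣p∣≡suc⇒Nonempty (N v) (cubic v)
  ... | a , a∈ = a , otherNeighbours (∈neighbourhood⁻ G a∈)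

-- Strong cliques of cubic graphs are locally recognisable

-- Opaque so that unification can recover the list from the subset.
opaque
  fromList : ∀ {n} → List (Fin n) → Subset n
  fromList xs = ⋃ (map ⁅_⁆ xs)

  ∈fromList⁺ : ∀ {n} {xs : List (Fin n)} {x} → x ∈ₗ xs → x ∈ fromList xs
  ∈fromList⁺ {x = x} (here refl) = x∈p∪q⁺ (inj₁ (x∈⁅x⁆ x))
  ∈fromList⁺ (there i)   = x∈p∪q⁺ (inj₂ (∈fromList⁺ i))

  ∈fromList⁻ : ∀ {n} (xs : List (Fin n)) {x} → x ∈ fromList xs → x ∈ₗ xs
  ∈fromList⁻ []       i = ⊥-elim (∉⊥ i)
  ∈fromList⁻ (y ∷ xs) i with x∈p∪q⁻ ⁅ y ⁆ (fromList xs) i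
  ... | inj₁ j = here (x∈⁅y⁆⇒x≡y y j)
  ... | inj₂ j = there (∈fromList⁻ xs j)

AllPairs-∈ : ∀ {A : Set} {R : A → A → Set} → Symmetric R → ∀ {xs x y} →
  AllPairs R xs → x ∈ₗ xs → y ∈ₗ xs → x ≡ y ⊎ R x y
AllPairs-∈ s (_ ∷ _)  (here refl) (here refl) = inj₁ refl
AllPairs-∈ s (r ∷ _)  (here refl) (there j)   = inj₂ (All.lookup r j)
AllPairs-∈ s (r ∷ _)  (there i)   (here refl) = inj₂ (s (All.lookup r i))
AllPairs-∈ s (_ ∷ rs) (there i)   (there j)   = AllPairs-∈ s rs i j

module _ {n : ℕ} (G : Graph (Fin n)) where
  open Graph G

  clique-fromList : ∀ {xs} → AllPairs Adj xs → Clique G (fromList xs)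
  clique-fromList {xs} p i j u≢v
    with AllPairs-∈ (~-sym {G = G}) p (∈fromList⁻ xs i) (∈fromList⁻ xs j)
  ... | inj₁ u≡v = contradiction u≡v u≢v
  ... | inj₂ u~v = u~v

  independent-fromList : ∀ {xs} → AllPairs (λ u v → ¬ Adj u v) xs → Independent G (fromList xs)
  independent-fromList {xs} p i j
    with AllPairs-∈ (_∘ ~-sym {G = G}) p (∈fromList⁻ xs i) (∈fromList⁻ xs j)
  ... | inj₁ refl = ~-irrefl {G = G}
  ... | inj₂ u≁v  = u≁v

  ∪-independent : ∀ {I v} → Independent G I → ¬ (∃[ w ] (w ∈ I × Adj v w)) → Independent G (I ∪ ⁅ v ⁆)
  ∪-independent {I} {v} ind free {x} {y} i j x~y with x∈p∪q⁻ I ⁅ v ⁆ i | x∈p∪q⁻ I ⁅ v ⁆ j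
  ... | inj₁ i′ | inj₁ j′ = ind i′ j′ x~y
  ... | inj₁ i′ | inj₂ j′ with x∈⁅y⁆⇒x≡y v j′
  ...   | refl = free (x , i′ , ~-sym {G = G} x~y)
  ∪-independent {I} {v} ind free {x} {y} i j x~y | inj₂ i′ | inj₁ j′ with x∈⁅y⁆⇒x≡y v i′
  ...   | refl = free (y , j′ , x~y)
  ∪-independent {I} {v} ind free {x} {y} i j x~y | inj₂ i′ | inj₂ j′
    with x∈⁅y⁆⇒x≡y v i′ | x∈⁅y⁆⇒x≡y v j′
  ...   | refl | refl = ~-irrefl {G = G} x~y

  Dominates : Subset n → Fin n → Set
  Dominates I v = ∃[ w ] (w ∈ I × Adj v w)

  dominates? : ∀ I v → Dec (Dominates I v)
  dominates? I v = any? (λ w → (w ∈? I) ×-dec _~?_ G v w)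

  extendIndependent : ∀ {I} → Independent G I → ∃[ J ] (MaximalIndependent G J × I ⊆ J)
  extendIndependent {I} indI
    with saturate {S = ∃[ J ] (Independent G J × I ⊆ J)}
      (λ (J , _) v → v ∈ J ⊎ Dominates J v) step (I , indI , id)
    where
    step : ∀ (s : ∃[ J ] (Independent G J × I ⊆ J)) v →
      Σ[ s′ ∈ ∃[ J ] (Independent G J × I ⊆ J) ]
        (v ∈ proj₁ s′ ⊎ Dominates (proj₁ s′) v) ×
        (∀ u → u ∈ proj₁ s ⊎ Dominates (proj₁ s) u → u ∈ proj₁ s′ ⊎ Dominates (proj₁ s′) u)
    step s@(J , indJ , I⊆J) v with dominates? J v
    ... | yes d = s , inj₂ d , λ _ → id
    ... | no ¬d = (J ∪ ⁅ v ⁆ , ∪-independent indJ ¬d , p⊆p∪q _ ∘ I⊆J)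
                , inj₁ (x∈p∪q⁺ (inj₂ (x∈⁅x⁆ v)))
                , λ { u (inj₁ i) → inj₁ (p⊆p∪q _ i)
                    ; u (inj₂ (w , i , e)) → inj₂ (w , p⊆p∪q _ i , e) }
  ... | (J , indJ , I⊆J) , covered = J , (indJ , maximal) , I⊆J
    where
    maximal : ∀ K → Independent G K → J ⊆ K → K ⊆ J
    maximal K indK J⊆K {v} v∈K with covered v
    ... | inj₁ v∈J = v∈J
    ... | inj₂ (w , w∈J , v~w) = contradiction v~w (indK v∈K (J⊆K w∈J))

  maximal⇒dominating : ∀ {I} → MaximalIndependent G I → ∀ v → v ∈ I ⊎ Dominates I v
  maximal⇒dominating {I} (ind , max) v with dominates? I v
  ... | yes d = inj₂ d
  ... | no ¬d = inj₁ (max _ (∪-independent ind ¬d) (p⊆p∪q _) (x∈p∪q⁺ (inj₂ (x∈⁅x⁆ v))))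

  -- A maximal independent set containing `I` has no vertex adjacent to `I`, so it would miss `C`.
  -- All necessary conditions on strong cliques come from a suitable choice of `I`.
  strong-undominated : ∀ {C I} → StrongClique G C → Independent G I →
    ¬ (∀ {u} → u ∈ C → Dominates I u)
  strong-undominated {C} (_ , meets) ind dom with extendIndependent ind
  ... | J , maxJ , I⊆J with meets J maxJ
  ... | u , u∈ with x∈p∩q⁻ C J u∈
  ... | u∈C , u∈J with dom u∈C
  ... | w , w∈I , u~w = proj₁ maxJ u∈J (I⊆J w∈I) u~w

  -- The singleton of `v` would dominate `C`.
  strong-maximal : ∀ {C} → StrongClique G C → ∀ v → ¬ (∀ {u} → u ∈ C → Adj u v)
  strong-maximal strong v all =
    strong-undominated strong (independent-fromList {v ∷ []} ([] ∷ []))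
      (λ u∈C → v , ∈fromList⁺ (here refl) , all u∈C)

module Strong {n : ℕ} (G : Graph (Fin n)) (cubic : Cubic G) where
  open Graph G
  open CubicGraph G cubic

  -- The number of neighbours of `v` in `C` decides the shape: zero contradicts maximality of the
  -- clique, and one, two, three give an edge, a triangle, a `K₄`. The required adjacencies hold
  -- because a non-adjacent choice of outer neighbours would dominate `C`.
  strongClique⇒locallyStrong : ∀ {C v} → StrongClique G C → v ∈ C → LocallyStrong G v
  strongClique⇒locallyStrong {C} {v} strong@(clique , _) v∈C = go (allNeighbours v)
    where
    members : ∀ {a b c} → ThreeNeighbours G v a b c → ∀ {u} → u ∈ C →
      u ≡ v ⊎ u ≡ a ⊎ u ≡ b ⊎ u ≡ c
    members t {u} u∈C with u ≟ᶠ v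
    ... | yes u≡v = inj₁ u≡v
    ... | no u≢v = inj₂ (neighbours t (clique v∈C u∈C (≢-sym u≢v)))

    none : ∀ {a b c} → ThreeNeighbours G v a b c → a ∉ C → b ∉ C → ¬ (c ∉ C)
    none t a∉ b∉ c∉ = strong-maximal G strong _ λ u∈C → case (members t u∈C) u∈C
      where
      case : ∀ {u} → u ≡ v ⊎ u ≡ _ ⊎ u ≡ _ ⊎ u ≡ _ → u ∈ C → Adj u _
      case (inj₁ refl) _ = ThreeNeighbours.v~a t
      case (inj₂ (inj₁ refl)) i = contradiction i a∉
      case (inj₂ (inj₂ (inj₁ refl))) i = contradiction i b∉
      case (inj₂ (inj₂ (inj₂ refl))) i = contradiction i c∉

    one : ∀ {u a₁ a₂} → ThreeNeighbours G v u a₁ a₂ → a₁ ∉ C → a₂ ∉ C → StrongEdge G v u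
    one {u} {a₁} {a₂} t a₁∉ a₂∉ with otherNeighbours (~-sym {G = G} (ThreeNeighbours.v~a t))
    ... | b₁ , b₂ , s = strongEdge t s
          (joined T.v~b S.v~b) (joined T.v~b S.v~c) (joined T.v~c S.v~b) (joined T.v~c S.v~c)
      where
      module T = ThreeNeighbours t
      module S = ThreeNeighbours s
      -- The case of equal `x` and `y` is included: the list is still independent, so the two ends
      -- share no neighbour.
      joined : ∀ {x y} → Adj v x → Adj u y → Adj x y
      joined {x} {y} v~x u~y with _~?_ G x y
      ... | yes x~y = x~y
      ... | no x≁y = ⊥-elim (strong-undominated G strong
              (independent-fromList G {x ∷ y ∷ []} ((x≁y ∷ []) ∷ [] ∷ []))
              (λ w∈C → case (members t w∈C) w∈C))
        where
        case : ∀ {w} → w ≡ v ⊎ w ≡ u ⊎ w ≡ a₁ ⊎ w ≡ a₂ → w ∈ C → Dominates G (fromList (x ∷ y ∷ [])) w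
        case (inj₁ refl) _ = x , ∈fromList⁺ (here refl) , v~x
        case (inj₂ (inj₁ refl)) _ = y , ∈fromList⁺ (there (here refl)) , u~y
        case (inj₂ (inj₂ (inj₁ refl))) i = contradiction i a₁∉
        case (inj₂ (inj₂ (inj₂ refl))) i = contradiction i a₂∉

    two : ∀ {b c p} → ThreeNeighbours G v b c p → b ∈ C → c ∈ C → p ∉ C → StrongTriangle G v b c
    two {b} {c} {p} t b∈ c∈ p∉
      with thirdNeighbour (~-sym {G = G} T.v~a) (clique b∈ c∈ T.a≢b) (~⇒≢ {G = G} T.v~b)
         | thirdNeighbour (~-sym {G = G} T.v~b) (clique c∈ b∈ (≢-sym T.a≢b)) (~⇒≢ {G = G} T.v~a)
      where module T = ThreeNeighbours t
    ... | q , tb | r , tc = strongTriangle t tb tc linked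
      where
      linked : Adj p q ⊎ Adj p r ⊎ Adj q r
      linked with _~?_ G p q | _~?_ G p r | _~?_ G q r
      ... | yes e | _ | _ = inj₁ e
      ... | no _ | yes e | _ = inj₂ (inj₁ e)
      ... | no _ | no _ | yes e = inj₂ (inj₂ e)
      ... | no p≁q | no p≁r | no q≁r = ⊥-elim (strong-undominated G strong
              (independent-fromList G ((p≁q ∷ p≁r ∷ []) ∷ (q≁r ∷ []) ∷ [] ∷ []))
              (λ w∈C → case (members t w∈C) w∈C))
        where
        case : ∀ {w} → w ≡ v ⊎ w ≡ b ⊎ w ≡ c ⊎ w ≡ p → w ∈ C →
          Dominates G (fromList (p ∷ q ∷ r ∷ [])) w
        case (inj₁ refl) _ = p , ∈fromList⁺ (here refl) , ThreeNeighbours.v~c t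
        case (inj₂ (inj₁ refl)) _ = q , ∈fromList⁺ (there (here refl)) , ThreeNeighbours.v~c tb
        case (inj₂ (inj₂ (inj₁ refl))) _ =
          r , ∈fromList⁺ (there (there (here refl))) , ThreeNeighbours.v~c tc
        case (inj₂ (inj₂ (inj₂ refl))) i = contradiction i p∉

    go : ∃[ a ] ∃[ b ] ∃[ c ] ThreeNeighbours G v a b c → LocallyStrong G v
    go (a , b , c , t) with a ∈? C | b ∈? C | c ∈? C
    ... | no a∉ | no b∉ | no c∉ = contradiction c∉ (none t a∉ b∉)
    ... | yes _ | no b∉ | no c∉ = inj₁ (a , one t b∉ c∉)
    ... | no a∉ | yes _ | no c∉ = inj₁ (b , one (swap₁₂ t) a∉ c∉)
    ... | no a∉ | no b∉ | yes _ = inj₁ (c , one (swap₁₂ (swap₂₃ t)) a∉ b∉)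
    ... | yes a∈ | yes b∈ | no c∉ = inj₂ (inj₁ (a , b , two t a∈ b∈ c∉))
    ... | yes a∈ | no b∉ | yes c∈ = inj₂ (inj₁ (a , c , two (swap₂₃ t) a∈ c∈ b∉))
    ... | no a∉ | yes b∈ | yes c∈ = inj₂ (inj₁ (b , c , two (swap₂₃ (swap₁₂ t)) b∈ c∈ a∉))
    ... | yes a∈ | yes b∈ | yes c∈ = inj₂ (inj₂ (a , b , c , tetrahedron t
            (clique a∈ b∈ T.a≢b) (clique a∈ c∈ T.a≢c) (clique b∈ c∈ T.b≢c)))
      where module T = ThreeNeighbours t

  private
    met : ∀ {xs} {I : Subset n} {x : Fin n} → x ∈ₗ xs → x ∈ I → Nonempty (fromList xs ∩ I)
    met {x = x} i j = x , x∈p∩q⁺ (∈fromList⁺ i , j)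

  strongEdge⇒strongClique : ∀ {v u} → StrongEdge G v u → StrongClique G (fromList (v ∷ u ∷ []))
  strongEdge⇒strongClique {v} {u} (strongEdge t s e₁₁ e₁₂ e₂₁ e₂₂) =
    clique-fromList G ((ThreeNeighbours.v~a t ∷ []) ∷ [] ∷ []) , meets
    where
    meets : ∀ I → MaximalIndependent G I → Nonempty (fromList (v ∷ u ∷ []) ∩ I)
    meets I max with maximal⇒dominating G max v | maximal⇒dominating G max u
    ... | inj₁ v∈I | _ = met (here refl) v∈I
    ... | inj₂ _ | inj₁ u∈I = met (there (here refl)) u∈I
    ... | inj₂ (x , x∈I , v~x) | inj₂ (y , y∈I , u~y) with neighbours t v~x | neighbours s u~y
    ... | inj₁ refl | _ = met (there (here refl)) x∈I
    ... | inj₂ _ | inj₁ refl = met (here refl) y∈I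
    ... | inj₂ (inj₁ refl) | inj₂ (inj₁ refl) = contradiction e₁₁ (proj₁ max x∈I y∈I)
    ... | inj₂ (inj₁ refl) | inj₂ (inj₂ refl) = contradiction e₁₂ (proj₁ max x∈I y∈I)
    ... | inj₂ (inj₂ refl) | inj₂ (inj₁ refl) = contradiction e₂₁ (proj₁ max x∈I y∈I)
    ... | inj₂ (inj₂ refl) | inj₂ (inj₂ refl) = contradiction e₂₂ (proj₁ max x∈I y∈I)

  strongTriangle⇒strongClique : ∀ {v b c} → StrongTriangle G v b c →
    StrongClique G (fromList (v ∷ b ∷ c ∷ []))
  strongTriangle⇒strongClique {v} {b} {c} (strongTriangle t tb tc linked) =
    clique-fromList G ((ThreeNeighbours.v~a t ∷ ThreeNeighbours.v~b t ∷ []) ∷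
                       (ThreeNeighbours.v~b tb ∷ []) ∷ [] ∷ []) , meets
    where
    meets : ∀ I → MaximalIndependent G I → Nonempty (fromList (v ∷ b ∷ c ∷ []) ∩ I)
    meets I max with maximal⇒dominating G max v | maximal⇒dominating G max b | maximal⇒dominating G max c
    ... | inj₁ i | _ | _ = met (here refl) i
    ... | inj₂ _ | inj₁ i | _ = met (there (here refl)) i
    ... | inj₂ _ | inj₂ _ | inj₁ i = met (there (there (here refl))) i
    ... | inj₂ (x , x∈I , v~x) | inj₂ (y , y∈I , b~y) | inj₂ (z , z∈I , c~z)
      with neighbours t v~x | neighbours tb b~y | neighbours tc c~z
    ... | inj₁ refl | _ | _ = met (there (here refl)) x∈I
    ... | inj₂ (inj₁ refl) | _ | _ = met (there (there (here refl))) x∈I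
    ... | _ | inj₁ refl | _ = met (here refl) y∈I
    ... | _ | inj₂ (inj₁ refl) | _ = met (there (there (here refl))) y∈I
    ... | _ | _ | inj₁ refl = met (here refl) z∈I
    ... | _ | _ | inj₂ (inj₁ refl) = met (there (here refl)) z∈I
    ... | inj₂ (inj₂ refl) | inj₂ (inj₂ refl) | inj₂ (inj₂ refl) =
      ⊥-elim ([ proj₁ max x∈I y∈I , [ proj₁ max x∈I z∈I , proj₁ max y∈I z∈I ]′ ]′ linked)

  -- The clique is the closed neighbourhood of `v`, so domination of `v` alone already meets it.
  tetrahedron⇒strongClique : ∀ {v a b c} → Tetrahedron G v a b c →
    StrongClique G (fromList (v ∷ a ∷ b ∷ c ∷ []))
  tetrahedron⇒strongClique {v} {a} {b} {c} (tetrahedron t a~b a~c b~c) =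
    clique-fromList G ((T.v~a ∷ T.v~b ∷ T.v~c ∷ []) ∷ (a~b ∷ a~c ∷ []) ∷ (b~c ∷ []) ∷ [] ∷ []) , meets
    where
    module T = ThreeNeighbours t
    meets : ∀ I → MaximalIndependent G I → Nonempty (fromList (v ∷ a ∷ b ∷ c ∷ []) ∩ I)
    meets I max with maximal⇒dominating G max v
    ... | inj₁ i = met (here refl) i
    ... | inj₂ (x , x∈I , v~x) with neighbours t v~x
    ... | inj₁ refl = met (there (here refl)) x∈I
    ... | inj₂ (inj₁ refl) = met (there (there (here refl))) x∈I
    ... | inj₂ (inj₂ refl) = met (there (there (there (here refl)))) x∈I

  locallyStrong⇒strongClique : ∀ {v} → LocallyStrong G v → ∃[ C ] (StrongClique G C × v ∈ C)
  locallyStrong⇒strongClique (inj₁ (_ , s)) = _ , strongEdge⇒strongClique s , ∈fromList⁺ (here refl)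
  locallyStrong⇒strongClique (inj₂ (inj₁ (_ , _ , s))) =
    _ , strongTriangle⇒strongClique s , ∈fromList⁺ (here refl)
  locallyStrong⇒strongClique (inj₂ (inj₂ (_ , _ , _ , s))) =
    _ , tetrahedron⇒strongClique s , ∈fromList⁺ (here refl)

-- Extending a disjoint family of strong cliques

module Bipartite {n : ℕ} (G : Graph (Fin n)) (cubic : Cubic G)
  {v u : Fin n} (e : StrongEdge G v u) where
  open Graph G
  open CubicGraph G cubic
  open StrongEdge e
  private
    module Tv = ThreeNeighbours around-v
    module Tu = ThreeNeighbours around-u

  -- The two sides of the `K₃,₃`, described by neighbourhoods instead of by lists of members, so
  -- that the three vertices of a side become interchangeable.
  Even Odd : Fin n → Set
  Even x = ThreeNeighbours G x u a₁ a₂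
  Odd y = ThreeNeighbours G y v b₁ b₂

  a₁-odd : Odd a₁
  a₁-odd = threeNeighbours Tu.a≢b Tu.a≢c Tu.b≢c (~-sym {G = G} Tv.v~b) a₁~b₁ a₁~b₂

  a₂-odd : Odd a₂
  a₂-odd = threeNeighbours Tu.a≢b Tu.a≢c Tu.b≢c (~-sym {G = G} Tv.v~c) a₂~b₁ a₂~b₂

  b₁-even : Even b₁
  b₁-even = threeNeighbours Tv.a≢b Tv.a≢c Tv.b≢c
    (~-sym {G = G} Tu.v~b) (~-sym {G = G} a₁~b₁) (~-sym {G = G} a₂~b₁)

  b₂-even : Even b₂
  b₂-even = threeNeighbours Tv.a≢b Tv.a≢c Tv.b≢c
    (~-sym {G = G} Tu.v~c) (~-sym {G = G} a₁~b₂) (~-sym {G = G} a₂~b₂)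

  even⇒odd : ∀ {x y} → Even x → Adj x y → Odd y
  even⇒odd t x~y with neighbours t x~y
  ... | inj₁ refl = around-u
  ... | inj₂ (inj₁ refl) = a₁-odd
  ... | inj₂ (inj₂ refl) = a₂-odd

  odd⇒even : ∀ {x y} → Odd y → Adj y x → Even x
  odd⇒even t y~x with neighbours t y~x
  ... | inj₁ refl = around-v
  ... | inj₂ (inj₁ refl) = b₁-even
  ... | inj₂ (inj₂ refl) = b₂-even

  -- An even vertex is adjacent to `u`, hence is `v`, `b₁` or `b₂`; an odd one is adjacent to all
  -- three, so it would be adjacent to itself.
  even⇒¬odd : ∀ {x} → Even x → ¬ Odd x
  even⇒¬odd x-even x-odd
    with neighbours around-u (~-sym {G = G} (ThreeNeighbours.v~a x-even))
  ... | inj₁ refl = ~-irrefl {G = G} (ThreeNeighbours.v~a x-odd)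
  ... | inj₂ (inj₁ refl) = ~-irrefl {G = G} (ThreeNeighbours.v~b x-odd)
  ... | inj₂ (inj₂ refl) = ~-irrefl {G = G} (ThreeNeighbours.v~c x-odd)

  -- A bipartite graph has no triangle. The triangle is placed one step away from `v` because `v`
  -- will be the tip next to a diamond.
  neighbour∉triangle : ∀ {s p q} → Adj v s → Adj s p → Adj s q → ¬ Adj p q
  neighbour∉triangle v~s s~p s~q p~q =
    even⇒¬odd (odd⇒even s-odd s~q) (even⇒odd (odd⇒even s-odd s~p) p~q)
    where s-odd = even⇒odd around-v v~s

  -- All edges of `K₃,₃` at `v` are strong, so an uncovered `v` may be matched with whichever
  -- neighbour is still free.
  strongEdge-a₁ : StrongEdge G v a₁
  strongEdge-a₁ = strongEdge (swap₁₂ around-v) a₁-odd Tu.v~b Tu.v~c a₂~b₁ a₂~b₂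

  strongEdge-a₂ : StrongEdge G v a₂
  strongEdge-a₂ = strongEdge (swap₁₂ (swap₂₃ around-v)) a₂-odd Tu.v~b Tu.v~c a₁~b₁ a₁~b₂

  module _ {D : Subset n} (D-strong : StrongClique G D) (v∉D : v ∉ D) where

    -- Otherwise `y` would be the only member of `D`, and its neighbour `v` would extend `D`.
    ∈strong : ∀ {y} → Odd y → y ∈ D → b₁ ∈ D ⊎ b₂ ∈ D
    ∈strong {y} y-odd y∈D with b₁ ∈? D | b₂ ∈? D
    ... | yes b₁∈D | _ = inj₁ b₁∈D
    ... | no _ | yes b₂∈D = inj₂ b₂∈D
    ... | no b₁∉D | no b₂∉D = ⊥-elim (strong-maximal G D-strong v adjacent)
      where
      adjacent : ∀ {x} → x ∈ D → Adj x v
      adjacent {x} x∈D with x ≟ᶠ y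
      ... | yes refl = ThreeNeighbours.v~a y-odd
      ... | no x≢y with neighbours y-odd (proj₁ D-strong y∈D x∈D (≢-sym x≢y))
      ... | inj₁ refl = contradiction x∈D v∉D
      ... | inj₂ (inj₁ refl) = contradiction x∈D b₁∉D
      ... | inj₂ (inj₂ refl) = contradiction x∈D b₂∉D

module LocallyStrongGraph {n : ℕ} (G : Graph (Fin n)) (cubic : Cubic G)
  (local : ∀ v → LocallyStrong G v) where
  open Graph G
  open CubicGraph G cubic
  open Strong G cubic

  noTriangleAt : ∀ {x a b c} → ThreeNeighbours G x a b c → ¬ Adj a b → ¬ Adj a c → ¬ Adj b c →
    ∀ {s t} → Adj x s → Adj x t → ¬ Adj s t
  noTriangleAt T a≁b a≁c b≁c x~s x~t s~t with neighbours T x~s | neighbours T x~t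
  ... | inj₁ refl        | inj₁ refl        = ~-irrefl {G = G} s~t
  ... | inj₁ refl        | inj₂ (inj₁ refl) = a≁b s~t
  ... | inj₁ refl        | inj₂ (inj₂ refl) = a≁c s~t
  ... | inj₂ (inj₁ refl) | inj₁ refl        = a≁b (~-sym {G = G} s~t)
  ... | inj₂ (inj₁ refl) | inj₂ (inj₁ refl) = ~-irrefl {G = G} s~t
  ... | inj₂ (inj₁ refl) | inj₂ (inj₂ refl) = b≁c s~t
  ... | inj₂ (inj₂ refl) | inj₁ refl        = a≁c (~-sym {G = G} s~t)
  ... | inj₂ (inj₂ refl) | inj₂ (inj₁ refl) = b≁c (~-sym {G = G} s~t)
  ... | inj₂ (inj₂ refl) | inj₂ (inj₂ refl) = ~-irrefl {G = G} s~t

  -- The tip p lies in no triangle, but its neighbour v does, so no strong clique contains p.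
  noDiamond : ∀ {v b c p q} → ThreeNeighbours G v b c p → ThreeNeighbours G b v c q →
    ThreeNeighbours G c v b q → ¬ Adj p q
  noDiamond {v} {b} {c} {p} {q} tv tb tc p~q
    with thirdNeighbour (~-sym {G = G} (ThreeNeighbours.v~c tv)) p~q (ThreeNeighbours.a≢c tb)
  ... | d , tp with local p
  ... | inj₁ (u , e) = Bipartite.neighbour∉triangle G cubic e
          (ThreeNeighbours.v~a tp) (ThreeNeighbours.v~a tv) (ThreeNeighbours.v~b tv) (ThreeNeighbours.v~b tb)
  ... | inj₂ shape = inTriangle shape
    where
    module Tv = ThreeNeighbours tv
    module Tb = ThreeNeighbours tb
    module Tc = ThreeNeighbours tc
    module Tp = ThreeNeighbours tp

    b≁p : ¬ Adj b p
    b≁p b~p with neighbours tb b~p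
    ... | inj₁ refl = ~-irrefl {G = G} Tv.v~c
    ... | inj₂ (inj₁ refl) = Tv.b≢c refl
    ... | inj₂ (inj₂ refl) = ~-irrefl {G = G} p~q

    c≁p : ¬ Adj c p
    c≁p c~p with neighbours tc c~p
    ... | inj₁ refl = ~-irrefl {G = G} Tv.v~c
    ... | inj₂ (inj₁ refl) = Tv.a≢c refl
    ... | inj₂ (inj₂ refl) = ~-irrefl {G = G} p~q

    v≁q : ¬ Adj v q
    v≁q v~q with neighbours tv v~q
    ... | inj₁ refl = ~-irrefl {G = G} Tb.v~c
    ... | inj₂ (inj₁ refl) = ~-irrefl {G = G} Tc.v~c
    ... | inj₂ (inj₂ refl) = ~-irrefl {G = G} p~q

    v≁d : ¬ Adj v d
    v≁d v~d with neighbours tv v~d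
    ... | inj₁ refl = b≁p (~-sym {G = G} Tp.v~c)
    ... | inj₂ (inj₁ refl) = c≁p (~-sym {G = G} Tp.v~c)
    ... | inj₂ (inj₂ refl) = ~-irrefl {G = G} Tp.v~c

    q≁d : ¬ Adj q d
    q≁d q~d with thirdNeighbour (~-sym {G = G} Tb.v~c) (~-sym {G = G} Tc.v~c) Tv.a≢b
    ... | p′ , tq with neighbours tq (~-sym {G = G} p~q) | neighbours tq q~d
    ... | inj₁ refl | _ = Tv.a≢c refl
    ... | inj₂ (inj₁ refl) | _ = Tv.b≢c refl
    ... | inj₂ (inj₂ refl) | inj₁ refl = b≁p (~-sym {G = G} Tp.v~c)
    ... | inj₂ (inj₂ refl) | inj₂ (inj₁ refl) = c≁p (~-sym {G = G} Tp.v~c)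
    ... | inj₂ (inj₂ refl) | inj₂ (inj₂ refl) = ~-irrefl {G = G} Tp.v~c

    inTriangle : ¬ (∃[ s ] ∃[ t ] StrongTriangle G p s t ⊎ (∃[ s ] ∃[ t ] ∃[ r ] Tetrahedron G p s t r))
    inTriangle (inj₁ (s , t , strongTriangle T S _ _)) = noTriangleAt tp v≁q v≁d q≁d
      (ThreeNeighbours.v~a T) (ThreeNeighbours.v~b T) (ThreeNeighbours.v~b S)
    inTriangle (inj₂ (s , t , r , tetrahedron T s~t _ _)) = noTriangleAt tp v≁q v≁d q≁d
      (ThreeNeighbours.v~a T) (ThreeNeighbours.v~b T) s~t

  module _ {D : Subset n} (strong : StrongClique G D) where
    private
      members : ∀ {b x y z} → ThreeNeighbours G b x y z → b ∈ D → ∀ {u} → u ∈ D →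
        u ≡ b ⊎ u ≡ x ⊎ u ≡ y ⊎ u ≡ z
      members {b} t b∈D {u} u∈D with u ≟ᶠ b
      ... | yes u≡b = inj₁ u≡b
      ... | no u≢b = inj₂ (neighbours t (proj₁ strong b∈D u∈D (≢-sym u≢b)))

    -- The neighbours of `a` are the rest of the `K₄`, so `D` stays inside it, and a missing `v`
    -- would be adjacent to all of `D`.
    tetrahedron⊆strong : ∀ {v a b c} → Tetrahedron G v a b c → a ∈ D → v ∈ D
    tetrahedron⊆strong {v} {a} {b} {c} (tetrahedron t a~b a~c b~c) a∈D with v ∈? D
    ... | yes v∈D = v∈D
    ... | no v∉D = ⊥-elim (strong-maximal G strong v λ u∈D → adjacent (members ta a∈D u∈D) u∈D)
      where
      module T = ThreeNeighbours t
      ta : ThreeNeighbours G a v b c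
      ta = threeNeighbours (~⇒≢ {G = G} T.v~b) (~⇒≢ {G = G} T.v~c) T.b≢c (~-sym {G = G} T.v~a) a~b a~c
      adjacent : ∀ {u} → u ≡ a ⊎ u ≡ v ⊎ u ≡ b ⊎ u ≡ c → u ∈ D → Adj u v
      adjacent (inj₁ refl) _ = ~-sym {G = G} T.v~a
      adjacent (inj₂ (inj₁ refl)) v∈D = contradiction v∈D v∉D
      adjacent (inj₂ (inj₂ (inj₁ refl))) _ = ~-sym {G = G} T.v~b
      adjacent (inj₂ (inj₂ (inj₂ refl))) _ = ~-sym {G = G} T.v~c

    -- If `v` is missing, `D` lies within `b`, `c`, `q`. Without `q` it could be extended by `v`.
    -- With both `c` and `q`, the edge from `b` to `c` lies in two triangles, which `noDiamond`
    -- forbids. What remains is a strong edge from `b` to `q`, incompatible with the triangle at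
    -- `b`.
    triangle⊆strong : ∀ {v b c} → StrongTriangle G v b c → b ∈ D → v ∈ D
    triangle⊆strong {v} {b} {c} (strongTriangle {p} {q} {r} tv tb tc linked) b∈D
      with v ∈? D | c ∈? D | q ∈? D
    ... | yes v∈D | _ | _ = v∈D
    ... | no v∉D | _ | no q∉D =
      ⊥-elim (strong-maximal G strong v λ u∈D → adjacent (members tb b∈D u∈D) u∈D)
      where
      adjacent : ∀ {u} → u ≡ b ⊎ u ≡ v ⊎ u ≡ c ⊎ u ≡ q → u ∈ D → Adj u v
      adjacent (inj₁ refl) _ = ThreeNeighbours.v~a tb
      adjacent (inj₂ (inj₁ refl)) v∈D = contradiction v∈D v∉D
      adjacent (inj₂ (inj₂ (inj₁ refl))) _ = ThreeNeighbours.v~a tc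
      adjacent (inj₂ (inj₂ (inj₂ refl))) q∈D = contradiction q∈D q∉D
    ... | no v∉D | yes c∈D | yes q∈D
      with neighbours tc (proj₁ strong c∈D q∈D (ThreeNeighbours.b≢c tb))
    ...   | inj₁ refl = contradiction refl (ThreeNeighbours.a≢c tb)
    ...   | inj₂ (inj₁ refl) = contradiction (ThreeNeighbours.v~c tb) (~-irrefl {G = G})
    ...   | inj₂ (inj₂ refl) = ⊥-elim (noDiamond tv tb tc
              ([ id , [ id , (λ e → contradiction e (~-irrefl {G = G})) ]′ ]′ linked))
    triangle⊆strong {v} {b} {c} (strongTriangle {p} {q} {r} tv tb tc linked) b∈D
      | no v∉D | no c∉D | yes q∈D with otherNeighbours (~-sym {G = G} (ThreeNeighbours.v~c tb))
    ... | y₁ , y₂ , tq = contradiction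
            (trans (y≡p (ThreeNeighbours.v~b tq) (≢-sym (ThreeNeighbours.a≢b tq)))
              (sym (y≡p (ThreeNeighbours.v~c tq) (≢-sym (ThreeNeighbours.a≢c tq)))))
            (ThreeNeighbours.b≢c tq)
      where
      joined : ∀ {x y} → Adj b x → Adj q y → Adj x y
      joined {x} {y} b~x q~y with _~?_ G x y
      ... | yes x~y = x~y
      ... | no x≁y = ⊥-elim (strong-undominated G strong
              (independent-fromList G ((x≁y ∷ []) ∷ [] ∷ []))
              (λ u∈D → dominated (members tb b∈D u∈D) u∈D))
        where
        dominated : ∀ {u} → u ≡ b ⊎ u ≡ v ⊎ u ≡ c ⊎ u ≡ q → u ∈ D →
          Dominates G (fromList (x ∷ y ∷ [])) u
        dominated (inj₁ refl) _ = x , ∈fromList⁺ (here refl) , b~x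
        dominated (inj₂ (inj₁ refl)) i = contradiction i v∉D
        dominated (inj₂ (inj₂ (inj₁ refl))) i = contradiction i c∉D
        dominated (inj₂ (inj₂ (inj₂ refl))) _ = y , ∈fromList⁺ (there (here refl)) , q~y

      -- The strong edge makes `v` and `c` adjacent to both other neighbours of `q`. Neither of
      -- these is `b` or `c`, so `v` has room only for `p`, which would have to be both.
      y≡p : ∀ {y} → Adj q y → y ≢ b → y ≡ p
      y≡p q~y y≢b with neighbours tv (joined (ThreeNeighbours.v~a tb) q~y)
      ... | inj₁ y≡b = contradiction y≡b y≢b
      ... | inj₂ (inj₁ refl) =
              contradiction (joined (ThreeNeighbours.v~b tb) q~y) (~-irrefl {G = G})
      ... | inj₂ (inj₂ eq) = eq

  record Packing : Set where
    constructor packing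
    field
      {size}   : ℕ
      part     : Fin size → Subset n
      strong   : ∀ i → StrongClique G (part i)
      nonempty : ∀ i → Nonempty (part i)
      disjoint : ∀ {i j v} → v ∈ part i → v ∈ part j → i ≡ j

  Covers : Packing → Fin n → Set
  Covers P v = ∃[ i ] v ∈ Packing.part P i

  module _ (P : Packing) where
    open Packing P

    DisjointStrongClique : Fin n → Set
    DisjointStrongClique v = ∃[ C ] (StrongClique G C × v ∈ C × (∀ {u i} → u ∈ C → u ∉ part i))

    module _ {v : Fin n} (uncovered : ∀ {i} → v ∉ part i) where

      disjointTriangle : ∀ {b c} → StrongTriangle G v b c → DisjointStrongClique v
      disjointTriangle {b} {c} t =
        _ , strongTriangle⇒strongClique t , ∈fromList⁺ (here refl) , avoids ∘ ∈fromList⁻ _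
        where
        avoids : ∀ {u i} → u ∈ₗ (v ∷ b ∷ c ∷ []) → u ∉ part i
        avoids (here refl) = uncovered
        avoids (there (here refl)) b∈ = uncovered (triangle⊆strong (strong _) t b∈)
        avoids (there (there (here refl))) c∈ =
          uncovered (triangle⊆strong (strong _) (swapTriangle t) c∈)

      disjointTetrahedron : ∀ {a b c} → Tetrahedron G v a b c → DisjointStrongClique v
      disjointTetrahedron {a} {b} {c} t@(tetrahedron tv a~b a~c b~c) =
        _ , tetrahedron⇒strongClique t , ∈fromList⁺ (here refl) , avoids ∘ ∈fromList⁻ _
        where
        avoids : ∀ {u i} → u ∈ₗ (v ∷ a ∷ b ∷ c ∷ []) → u ∉ part i
        avoids (here refl) = uncovered
        avoids (there (here refl)) a∈ = uncovered (tetrahedron⊆strong (strong _) t a∈)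
        avoids (there (there (here refl))) b∈ = uncovered (tetrahedron⊆strong (strong _)
          (tetrahedron (swap₁₂ tv) (~-sym {G = G} a~b) b~c a~c) b∈)
        avoids (there (there (there (here refl)))) c∈ = uncovered (tetrahedron⊆strong (strong _)
          (tetrahedron (swap₁₂ (swap₂₃ tv)) (~-sym {G = G} a~c) (~-sym {G = G} b~c) a~b) c∈)

      uncoveredEdge : ∀ {y} → StrongEdge G v y → ¬ (∃[ i ] y ∈ part i) → DisjointStrongClique v
      uncoveredEdge {y} e y∉ =
        _ , strongEdge⇒strongClique e , ∈fromList⁺ (here refl) , avoids ∘ ∈fromList⁻ _
        where
        avoids : ∀ {w i} → w ∈ₗ (v ∷ y ∷ []) → w ∉ part i
        avoids (here refl) = uncovered
        avoids (there (here refl)) y∈ = y∉ (_ , y∈)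

      -- If all neighbours of v were covered, two of them would share a part with the same bᵢ.
      disjointEdge : ∀ {u} → StrongEdge G v u → DisjointStrongClique v
      disjointEdge {u} e = go
        (any? (λ i → u ∈? part i)) (any? (λ i → a₁ ∈? part i)) (any? (λ i → a₂ ∈? part i))
        where
        open StrongEdge e
        open Bipartite G cubic e

        apart : ∀ {y z b i j} → Odd y → Odd z → y ≢ z →
          y ∈ part i → z ∈ part j → b ∈ part i → b ∈ part j → ⊥
        apart y-odd z-odd y≢z y∈ z∈ b∈ b∈′ with disjoint b∈ b∈′
        ... | refl = even⇒¬odd (odd⇒even y-odd (proj₁ (strong _) y∈ z∈ y≢z)) z-odd

        pigeonhole : ∀ {i j k} → u ∈ part i → a₁ ∈ part j → a₂ ∈ part k →
          b₁ ∈ part i ⊎ b₂ ∈ part i → b₁ ∈ part j ⊎ b₂ ∈ part j → b₁ ∈ part k ⊎ b₂ ∈ part k → ⊥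
        pigeonhole u∈ a₁∈ a₂∈ = λ
          { (inj₁ p) (inj₁ q) _ → apart around-u a₁-odd T.a≢b u∈ a₁∈ p q
          ; (inj₂ p) (inj₂ q) _ → apart around-u a₁-odd T.a≢b u∈ a₁∈ p q
          ; (inj₁ p) (inj₂ _) (inj₁ r) → apart around-u a₂-odd T.a≢c u∈ a₂∈ p r
          ; (inj₂ p) (inj₁ _) (inj₂ r) → apart around-u a₂-odd T.a≢c u∈ a₂∈ p r
          ; (inj₁ _) (inj₂ q) (inj₂ r) → apart a₁-odd a₂-odd T.b≢c a₁∈ a₂∈ q r
          ; (inj₂ _) (inj₁ q) (inj₁ r) → apart a₁-odd a₂-odd T.b≢c a₁∈ a₂∈ q r }
          where module T = ThreeNeighbours around-v

        go : Dec (∃[ i ] u ∈ part i) → Dec (∃[ i ] a₁ ∈ part i) → Dec (∃[ i ] a₂ ∈ part i) →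
          DisjointStrongClique v
        go (no u∉) _ _ = uncoveredEdge e u∉
        go (yes _) (no a₁∉) _ = uncoveredEdge strongEdge-a₁ a₁∉
        go (yes _) (yes _) (no a₂∉) = uncoveredEdge strongEdge-a₂ a₂∉
        go (yes (i , u∈)) (yes (j , a₁∈)) (yes (k , a₂∈)) = ⊥-elim (pigeonhole u∈ a₁∈ a₂∈
          (∈strong (strong i) uncovered around-u u∈)
          (∈strong (strong j) uncovered a₁-odd a₁∈)
          (∈strong (strong k) uncovered a₂-odd a₂∈))

      disjointStrongClique : DisjointStrongClique v
      disjointStrongClique with local v
      ... | inj₁ (_ , e) = disjointEdge e
      ... | inj₂ (inj₁ (_ , _ , t)) = disjointTriangle t
      ... | inj₂ (inj₂ (_ , _ , _ , t)) = disjointTetrahedron t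

  cover : ∀ P v → Σ[ Q ∈ Packing ] Covers Q v × (∀ u → Covers P u → Covers Q u)
  cover P v with any? (λ i → v ∈? Packing.part P i)
  ... | yes c = P , c , λ _ → id
  ... | no ¬c with disjointStrongClique P (λ {i} v∈ → ¬c (i , v∈))
  ... | C , C-strong , v∈C , avoids = record
          { part     = C ◂ part
          ; strong   = λ { zero → C-strong ; (suc i) → strong i }
          ; nonempty = λ { zero → v , v∈C ; (suc i) → nonempty i }
          ; disjoint = λ { {zero}  {zero}  _ _ → refl
                         ; {zero}  {suc j} p q → contradiction q (avoids p)
                         ; {suc i} {zero}  p q → contradiction p (avoids q)
                         ; {suc i} {suc j} p q → cong suc (disjoint p q) }
          }
        , (zero , v∈C) , λ _ (i , u∈) → suc i , u∈
    where open Packing P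

  localizable : Localizable G
  localizable with saturate Covers cover (packing {0} (λ ()) (λ ()) (λ ()) λ { {()} })
  ... | P , covers = _ , part
      , (nonempty , λ v → let (i , v∈) = covers v in i , v∈ , λ v∈′ → disjoint v∈ v∈′) , strong
    where open Packing P

localizable⇒everyVertexInStrongClique : ∀ {n} (G : Graph (Fin n)) → Localizable G → EveryVertexInStrongClique G
localizable⇒everyVertexInStrongClique G (k , P , (_ , unique) , strong) v =
  let (i , v∈ , _) = unique v in P i , strong i , v∈

everyVertexInStrongClique⇒locallyStrong : ∀ {n} (G : Graph (Fin n)) → Cubic G →
  EveryVertexInStrongClique G → ∀ v → LocallyStrong G v
everyVertexInStrongClique⇒locallyStrong G cubic all v =
  let (_ , strong , v∈) = all v in Strong.strongClique⇒locallyStrong G cubic strong v∈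

-- Embeddings of three-regular graphs

-- Non-edges need not be preserved: for a three-regular source and a cubic target, reflection of
-- edges follows by counting neighbours.
record _↪_ {W V : Set} (H : Graph W) (G : Graph V) : Set where
  field
    to        : W → V
    injective : ∀ {x y} → to x ≡ to y → x ≡ y
    preserves : ∀ {x y} → Graph.Adj H x y → Graph.Adj G (to x) (to y)

infix 4 _↪_

↪-trans : ∀ {U V W : Set} {F : Graph U} {G : Graph V} {H : Graph W} → F ↪ G → G ↪ H → F ↪ H
↪-trans f g = record
  { to        = _↪_.to g ∘ _↪_.to f
  ; injective = _↪_.injective f ∘ _↪_.injective g
  ; preserves = _↪_.preserves g ∘ _↪_.preserves f
  }

module _ {V W : Set} {G : Graph V} {H : Graph W} (iso : G ≅ H) where
  open _≅_ iso
  open Inverse bijection using () renaming (to to f; from to g; strictlyInverseˡ to f∘g; strictlyInverseʳ to g∘f)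

  ≅⇒↪ : G ↪ H
  ≅⇒↪ = record
    { to        = f
    ; injective = λ {x} {y} eq → trans (sym (g∘f x)) (trans (cong g eq) (g∘f y))
    ; preserves = λ {x} {y} → trans (sym (preserves x y))
    }

  ≅⇒↩ : H ↪ G
  ≅⇒↩ = record
    { to        = g
    ; injective = λ {x} {y} eq → trans (sym (f∘g x)) (trans (cong f eq) (f∘g y))
    ; preserves = λ {x} {y} → trans (trans (preserves (g x) (g y)) (cong₂ (Graph.adj H) (f∘g x) (f∘g y)))
    }

module _ {V W : Set} {G : Graph V} {H : Graph W} (emb : H ↪ G) where
  open _↪_ emb renaming (to to f)

  map-threeNeighbours : ∀ {v a b c} → ThreeNeighbours H v a b c → ThreeNeighbours G (f v) (f a) (f b) (f c)
  map-threeNeighbours (threeNeighbours ab ac bc a b c) = threeNeighbours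
    (ab ∘ injective) (ac ∘ injective) (bc ∘ injective) (preserves a) (preserves b) (preserves c)

  map-locallyStrong : ∀ {w} → LocallyStrong H w → LocallyStrong G (f w)
  map-locallyStrong (inj₁ (_ , strongEdge t s e₁₁ e₁₂ e₂₁ e₂₂)) =
    inj₁ (_ , strongEdge (map-threeNeighbours t) (map-threeNeighbours s)
      (preserves e₁₁) (preserves e₁₂) (preserves e₂₁) (preserves e₂₂))
  map-locallyStrong (inj₂ (inj₁ (_ , _ , strongTriangle t s r linked))) =
    inj₂ (inj₁ (_ , _ , strongTriangle
      (map-threeNeighbours t) (map-threeNeighbours s) (map-threeNeighbours r)
      ([ inj₁ ∘ preserves , [ inj₂ ∘ inj₁ ∘ preserves , inj₂ ∘ inj₂ ∘ preserves ]′ ]′ linked)))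
  map-locallyStrong (inj₂ (inj₂ (_ , _ , _ , tetrahedron t ab ac bc))) =
    inj₂ (inj₂ (_ , _ , _ , tetrahedron (map-threeNeighbours t) (preserves ab) (preserves ac) (preserves bc)))

≅-locallyStrong : ∀ {V W : Set} {G : Graph V} {H : Graph W} → G ≅ H →
  (∀ w → LocallyStrong H w) → ∀ v → LocallyStrong G v
≅-locallyStrong {G = G} iso local v = subst (LocallyStrong G) (Inverse.strictlyInverseʳ (_≅_.bijection iso) v)
  (map-locallyStrong (≅⇒↩ iso) (local (Inverse.to (_≅_.bijection iso) v)))

true-ext : ∀ {b c : Bool} → (b ≡ true → c ≡ true) → (c ≡ true → b ≡ true) → b ≡ c
true-ext {true}  {c}     f g = sym (f refl)
true-ext {false} {true}  f g = g refl
true-ext {false} {false} f g = refl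

locallyStrong⇒threeNeighbours : ∀ {V : Set} {G : Graph V} {v} → LocallyStrong G v →
  ∃[ a ] ∃[ b ] ∃[ c ] ThreeNeighbours G v a b c
locallyStrong⇒threeNeighbours (inj₁ (_ , s)) = _ , _ , _ , StrongEdge.around-v s
locallyStrong⇒threeNeighbours (inj₂ (inj₁ (_ , _ , s))) = _ , _ , _ , StrongTriangle.around-v s
locallyStrong⇒threeNeighbours (inj₂ (inj₂ (_ , _ , _ , s))) = _ , _ , _ , Tetrahedron.around-v s

-- The image of H is closed under taking neighbours because H already accounts for
-- all three edges at each of its vertices.
module _ {n : ℕ} (G : Graph (Fin n)) (connected : Connected G) (cubic : Cubic G)
  {W : Set} {H : Graph W} (threeRegular : ∀ w → ∃[ a ] ∃[ b ] ∃[ c ] ThreeNeighbours H w a b c) where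
  open CubicGraph G cubic

  ↪⇒≅ : W → H ↪ G → G ≅ H
  ↪⇒≅ w₀ emb = record
    { bijection = mk↔ₛ′ g f (λ w → injective (f∘g (f w))) f∘g
    ; preserves = λ u v → true-ext
        (λ u~v → reflects (subst₂ (Graph.Adj G) (sym (f∘g u)) (sym (f∘g v)) u~v))
        (λ gu~gv → subst₂ (Graph.Adj G) (f∘g u) (f∘g v) (preserves gu~gv))
    }
    where
    open _↪_ emb renaming (to to f)

    lift : ∀ {w u} → Graph.Adj G (f w) u → ∃[ w′ ] (Graph.Adj H w w′ × f w′ ≡ u)
    lift {w} e with threeRegular w
    ... | a , b , c , t with neighbours (map-threeNeighbours emb t) e
    ... | inj₁ eq = a , ThreeNeighbours.v~a t , sym eq
    ... | inj₂ (inj₁ eq) = b , ThreeNeighbours.v~b t , sym eq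
    ... | inj₂ (inj₂ eq) = c , ThreeNeighbours.v~c t , sym eq

    reachable : ∀ {w u} → Star (Graph.Adj G) (f w) u → ∃[ w′ ] f w′ ≡ u
    reachable {w} ε = w , refl
    reachable (e ◅ es) with lift e
    ... | w′ , _ , refl = reachable es

    g : Fin n → W
    g u = proj₁ (reachable (proj₂ connected (f w₀) u))

    f∘g : ∀ u → f (g u) ≡ u
    f∘g u = proj₂ (reachable (proj₂ connected (f w₀) u))

    reflects : ∀ {x y} → Graph.Adj G (f x) (f y) → Graph.Adj H x y
    reflects {x} e with lift e
    ... | y′ , x~y′ , eq = subst (Graph.Adj H x) (injective eq) x~y′

-- Local strength of the listed graphs

K₃,₃-locallyStrong : ∀ w → LocallyStrong K₃,₃ w
K₃,₃-locallyStrong = λ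
  { (inj₁ i) → let (j , k , ij , ik , jk) = others i in inj₁ (inj₂ 0F , strongEdge
      {a₁ = inj₂ 1F} {inj₂ 2F} {inj₁ j} {inj₁ k} (threeNeighbours (λ ()) (λ ()) (λ ()) refl refl refl)
      (threeNeighbours (ij ∘ inj₁-injective) (ik ∘ inj₁-injective) (jk ∘ inj₁-injective) refl refl refl)
      refl refl refl refl)
  ; (inj₂ i) → let (j , k , ij , ik , jk) = others i in inj₁ (inj₁ 0F , strongEdge
      {a₁ = inj₁ 1F} {inj₁ 2F} {inj₂ j} {inj₂ k} (threeNeighbours (λ ()) (λ ()) (λ ()) refl refl refl)
      (threeNeighbours (ij ∘ inj₂-injective) (ik ∘ inj₂-injective) (jk ∘ inj₂-injective) refl refl refl)
      refl refl refl refl)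
  }
  where
  others : (i : Fin 3) → ∃[ j ] ∃[ k ] (i ≢ j × i ≢ k × j ≢ k)
  others 0F = 1F , 2F , (λ ()) , (λ ()) , λ ()
  others 1F = 0F , 2F , (λ ()) , (λ ()) , λ ()
  others 2F = 0F , 1F , (λ ()) , (λ ()) , λ ()

K₄-locallyStrong : ∀ w → LocallyStrong K₄ w
K₄-locallyStrong 0F = inj₂ (inj₂ (1F , 2F , 3F ,
  tetrahedron (threeNeighbours (λ ()) (λ ()) (λ ()) refl refl refl) refl refl refl))
K₄-locallyStrong 1F = inj₂ (inj₂ (0F , 2F , 3F ,
  tetrahedron (threeNeighbours (λ ()) (λ ()) (λ ()) refl refl refl) refl refl refl))
K₄-locallyStrong 2F = inj₂ (inj₂ (0F , 1F , 3F ,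
  tetrahedron (threeNeighbours (λ ()) (λ ()) (λ ()) refl refl refl) refl refl refl))
K₄-locallyStrong 3F = inj₂ (inj₂ (0F , 1F , 2F ,
  tetrahedron (threeNeighbours (λ ()) (λ ()) (λ ()) refl refl refl) refl refl refl))

≡ᵇ⁺ : ∀ {m n} → m ≡ n → (m ≡ᵇ n) ≡ true
≡ᵇ⁺ {m} {n} = dec-true (m ≟ⁿ n)

module _ {m : ℕ} where
  blockEdge⇒Adj : ∀ {i : Fin m} a b → blockEdge a b ∨ blockEdge b a ≡ true →
    Graph.Adj (F m) (i , a) (i , b)
  blockEdge⇒Adj {i} a b e rewrite dec-true (i ≟ᶠ i) refl with blockEdge a b
  ... | true = refl
  ... | false rewrite e = ∨-zeroʳ _

  isNext⇒Adj : ∀ {i j : Fin m} → isNext i j ≡ true → Graph.Adj (F m) (i , 𝐱) (j , 𝐱′)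
  isNext⇒Adj {i} {j} e rewrite e with i ≟ᶠ j
  ... | yes _ = refl
  ... | no _ = refl

∨-trueˡ : ∀ {b c} → b ≡ true → b ∨ c ≡ true
∨-trueˡ refl = refl

successor : ∀ {m} (i : Fin (suc m)) → ∃[ j ] isNext i j ≡ true
successor i with view i
... | ‵fromℕ {m} = 0F , cong (_∧ true) (≡ᵇ⁺ (cong suc (toℕ-fromℕ m)))
... | ‵inject₁ j = suc j , ∨-trueˡ (≡ᵇ⁺ (sym (toℕ-inject₁ j)))

predecessor : ∀ {m} (j : Fin (suc m)) → ∃[ i ] isNext i j ≡ true
predecessor {m} zero = fromℕ m , cong (_∧ true) (≡ᵇ⁺ (cong suc (toℕ-fromℕ m)))
predecessor (suc j)  = inject₁ j , ∨-trueˡ (≡ᵇ⁺ (sym (toℕ-inject₁ j)))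

module _ {m : ℕ} (i : Fin (suc m)) where
  private
    H = F (suc m)

    _─_ : ∀ a b {_ : T (blockEdge a b ∨ blockEdge b a)} → Graph.Adj H (i , a) (i , b)
    (a ─ b) {e} = blockEdge⇒Adj {i = i} a b (Equivalence.to T-≡ e)

    next previous : Fin (suc m)
    next = proj₁ (successor i)
    previous = proj₁ (predecessor i)

  F-triangle : StrongTriangle H (i , 𝐱) (i , 𝐲) (i , 𝐳)
  F-triangle = strongTriangle {p = next , 𝐱′} {i , 𝐲′} {i , 𝐳′}
    -- Distinctness is visible from the labels alone, so it also holds for a single block, where
    -- `next` is `i`.
    (threeNeighbours (λ ()) (λ ()) (λ ()) (𝐱 ─ 𝐲) (𝐱 ─ 𝐳) (isNext⇒Adj {i = i} (proj₂ (successor i))))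
    (threeNeighbours (λ ()) (λ ()) (λ ()) (𝐲 ─ 𝐱) (𝐲 ─ 𝐳) (𝐲 ─ 𝐲′))
    (threeNeighbours (λ ()) (λ ()) (λ ()) (𝐳 ─ 𝐱) (𝐳 ─ 𝐲) (𝐳 ─ 𝐳′))
    (inj₂ (inj₂ (𝐲′ ─ 𝐳′)))

  F-triangle′ : StrongTriangle H (i , 𝐱′) (i , 𝐲′) (i , 𝐳′)
  F-triangle′ = strongTriangle {p = previous , 𝐱} {i , 𝐲} {i , 𝐳}
    (threeNeighbours (λ ()) (λ ()) (λ ()) (𝐱′ ─ 𝐲′) (𝐱′ ─ 𝐳′)
      (~-sym {G = H} {previous , 𝐱} {i , 𝐱′} (isNext⇒Adj {i = previous} (proj₂ (predecessor i)))))
    (threeNeighbours (λ ()) (λ ()) (λ ()) (𝐲′ ─ 𝐱′) (𝐲′ ─ 𝐳′) (𝐲′ ─ 𝐲))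
    (threeNeighbours (λ ()) (λ ()) (λ ()) (𝐳′ ─ 𝐱′) (𝐳′ ─ 𝐲′) (𝐳′ ─ 𝐳))
    (inj₂ (inj₂ (𝐲 ─ 𝐳)))

F-locallyStrong : ∀ {m} w → LocallyStrong (F (suc m)) w
F-locallyStrong (i , 𝐱)  = inj₂ (inj₁ (_ , _ , F-triangle i))
F-locallyStrong (i , 𝐲)  = inj₂ (inj₁ (_ , _ , rotateTriangle (F-triangle i)))
F-locallyStrong (i , 𝐳)  = inj₂ (inj₁ (_ , _ , rotateTriangle (swapTriangle (F-triangle i))))
F-locallyStrong (i , 𝐱′) = inj₂ (inj₁ (_ , _ , F-triangle′ i))
F-locallyStrong (i , 𝐲′) = inj₂ (inj₁ (_ , _ , rotateTriangle (F-triangle′ i)))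
F-locallyStrong (i , 𝐳′) = inj₂ (inj₁ (_ , _ , rotateTriangle (swapTriangle (F-triangle′ i))))

-- Both are the triangular prism: the even and the odd vertices of the hexagon are the two triangles
-- of its complement, and opposite vertices of the hexagon are joined.
C₆-complement≅F₁ : C₆-complement ≅ F 1
C₆-complement≅F₁ = record
  { bijection = mk↔ₛ′ to from to∘from from∘to
  ; preserves = toWitness {a? = all? λ u → all? λ v →
      Graph.adj C₆-complement u v ≟ᵇ Graph.adj (F 1) (to u) (to v)} _
  }
  where
  to : Fin 6 → Fin 1 × Label
  to 0F = 0F , 𝐱
  to 1F = 0F , 𝐳′
  to 2F = 0F , 𝐲
  to 3F = 0F , 𝐱′
  to 4F = 0F , 𝐳
  to 5F = 0F , 𝐲′
  from : Fin 1 × Label → Fin 6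
  from (0F , 𝐱)  = 0F
  from (0F , 𝐲)  = 2F
  from (0F , 𝐳)  = 4F
  from (0F , 𝐱′) = 3F
  from (0F , 𝐲′) = 5F
  from (0F , 𝐳′) = 1F
  to∘from : ∀ w → to (from w) ≡ w
  to∘from (0F , 𝐱)  = refl
  to∘from (0F , 𝐲)  = refl
  to∘from (0F , 𝐳)  = refl
  to∘from (0F , 𝐱′) = refl
  to∘from (0F , 𝐲′) = refl
  to∘from (0F , 𝐳′) = refl
  from∘to : ∀ v → from (to v) ≡ v
  from∘to = toWitness {a? = all? λ v → from (to v) ≟ᶠ v} _

C₆-complement-locallyStrong : ∀ w → LocallyStrong C₆-complement w
C₆-complement-locallyStrong = ≅-locallyStrong C₆-complement≅F₁ F-locallyStrong

-- Blocks and their cyclic arrangement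

∨-true⁻ : ∀ b {c} → b ∨ c ≡ true → b ≡ true ⊎ c ≡ true
∨-true⁻ true  _ = inj₁ refl
∨-true⁻ false e = inj₂ e

∧-true⁻ : ∀ b {c} → b ∧ c ≡ true → b ≡ true × c ≡ true
∧-true⁻ true e = refl , e

does-true⁻ : ∀ {P : Set} (P? : Dec P) → does P? ≡ true → P
does-true⁻ (yes p) _ = p

≡ᵇ⁻ : ∀ {m n} → (m ≡ᵇ n) ≡ true → m ≡ n
≡ᵇ⁻ {m} {n} = does-true⁻ (m ≟ⁿ n)

isNext⁻ : ∀ {m} {i j : Fin (suc m)} → isNext i j ≡ true →
  toℕ j ≡ suc (toℕ i) ⊎ (i ≡ fromℕ m × j ≡ zero)
isNext⁻ {m} {i} {j} e with ∨-true⁻ (toℕ j ≡ᵇ suc (toℕ i)) e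
... | inj₁ e₁ = inj₁ (≡ᵇ⁻ e₁)
... | inj₂ e₂ with ∧-true⁻ (suc (toℕ i) ≡ᵇ suc m) e₂
... | e₃ , e₄ = inj₂ ( toℕ-injective (trans (suc-injective (≡ᵇ⁻ {suc (toℕ i)} {suc m} e₃)) (sym (toℕ-fromℕ m)))
                     , toℕ-injective (≡ᵇ⁻ e₄))

linkEdge⁻ : ∀ a b → linkEdge a b ≡ true → a ≡ 𝐱 × b ≡ 𝐱′
linkEdge⁻ 𝐱 𝐱′ _ = refl , refl

-- The symmetry of a block exchanging its triangles; arguments about one triangle carry over to the
-- other by `flip`.
flipLabel : Label → Label
flipLabel 𝐱  = 𝐱′
flipLabel 𝐲  = 𝐲′
flipLabel 𝐳  = 𝐳′
flipLabel 𝐱′ = 𝐱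
flipLabel 𝐲′ = 𝐲
flipLabel 𝐳′ = 𝐳

flipLabel-involutive : ∀ a → flipLabel (flipLabel a) ≡ a
flipLabel-involutive 𝐱  = refl
flipLabel-involutive 𝐲  = refl
flipLabel-involutive 𝐳  = refl
flipLabel-involutive 𝐱′ = refl
flipLabel-involutive 𝐲′ = refl
flipLabel-involutive 𝐳′ = refl

module Blocks {n : ℕ} (G : Graph (Fin n)) (cubic : Cubic G)
  (triangles : ∀ v → ∃[ b ] ∃[ c ] StrongTriangle G v b c) where
  open Graph G
  open CubicGraph G cubic
  open LocallyStrongGraph G cubic (λ v → inj₂ (inj₁ (triangles v)))

  -- `outer` may be the block's own `𝐱′`, as in the prism. Distinctness of the six vertices is not
  -- assumed in full: `vertex-injective` derives it.
  record Block : Set where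
    field
      vertex : Label → Fin n
      {outer outer′} : Fin n
      at-x  : ThreeNeighbours G (vertex 𝐱) (vertex 𝐲) (vertex 𝐳) outer
      at-y  : ThreeNeighbours G (vertex 𝐲) (vertex 𝐱) (vertex 𝐳) (vertex 𝐲′)
      at-z  : ThreeNeighbours G (vertex 𝐳) (vertex 𝐱) (vertex 𝐲) (vertex 𝐳′)
      at-x′ : ThreeNeighbours G (vertex 𝐱′) (vertex 𝐲′) (vertex 𝐳′) outer′
      at-y′ : ThreeNeighbours G (vertex 𝐲′) (vertex 𝐱′) (vertex 𝐳′) (vertex 𝐲)
      at-z′ : ThreeNeighbours G (vertex 𝐳′) (vertex 𝐱′) (vertex 𝐲′) (vertex 𝐳)

  open Block

  flip : Block → Block
  flip B = record
    { vertex = vertex B ∘ flipLabel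
    ; at-x = at-x′ B ; at-y = at-y′ B ; at-z = at-z′ B
    ; at-x′ = at-x B ; at-y′ = at-y B ; at-z′ = at-z B
    }

  _∈ᴮ_ : Fin n → Block → Set
  v ∈ᴮ B = ∃[ a ] v ≡ vertex B a

  ∈flip⁻ : ∀ {v} B → v ∈ᴮ flip B → v ∈ᴮ B
  ∈flip⁻ B (a , eq) = flipLabel a , eq

  module _ (B : Block) where
    private
      V = vertex B
      module X = ThreeNeighbours (at-x B)
      module Y = ThreeNeighbours (at-y B)
      module Z = ThreeNeighbours (at-z B)
      module X′ = ThreeNeighbours (at-x′ B)
      module Y′ = ThreeNeighbours (at-y′ B)
      module Z′ = ThreeNeighbours (at-z′ B)

    -- A common vertex would have the four distinct neighbours `𝐲`, `𝐳`, `𝐲′`, `𝐳′`.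
    𝐱≢𝐱′ : V 𝐱 ≢ V 𝐱′
    𝐱≢𝐱′ eq with neighbours (at-x B) (subst (λ v → Adj v (V 𝐲′)) (sym eq) X′.v~a)
                | neighbours (at-x B) (subst (λ v → Adj v (V 𝐳′)) (sym eq) X′.v~b)
    ... | inj₁ e | _ = ~⇒≢ {G = G} Y′.v~c e
    ... | inj₂ (inj₁ e) | _ = Y.b≢c (sym e)
    ... | inj₂ (inj₂ _) | inj₁ e = Z.b≢c (sym e)
    ... | inj₂ (inj₂ _) | inj₂ (inj₁ e) = ~⇒≢ {G = G} Z′.v~c e
    ... | inj₂ (inj₂ e) | inj₂ (inj₂ e′) = X′.a≢b (trans e (sym e′))

    vertex-injective : ∀ a b → V a ≡ V b → a ≡ b
    vertex-injective 𝐱  𝐱  _ = refl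
    vertex-injective 𝐱  𝐲  e = contradiction e (~⇒≢ {G = G} X.v~a)
    vertex-injective 𝐱  𝐳  e = contradiction e (~⇒≢ {G = G} X.v~b)
    vertex-injective 𝐱  𝐱′ e = contradiction e 𝐱≢𝐱′
    vertex-injective 𝐱  𝐲′ e = contradiction e Y.a≢c
    vertex-injective 𝐱  𝐳′ e = contradiction e Z.a≢c
    vertex-injective 𝐲  𝐱  e = contradiction e (~⇒≢ {G = G} Y.v~a)
    vertex-injective 𝐲  𝐲  _ = refl
    vertex-injective 𝐲  𝐳  e = contradiction e (~⇒≢ {G = G} Y.v~b)
    vertex-injective 𝐲  𝐱′ e = contradiction (sym e) Y′.a≢c
    vertex-injective 𝐲  𝐲′ e = contradiction e (~⇒≢ {G = G} Y.v~c)
    vertex-injective 𝐲  𝐳′ e = contradiction e Z.b≢c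
    vertex-injective 𝐳  𝐱  e = contradiction e (~⇒≢ {G = G} Z.v~a)
    vertex-injective 𝐳  𝐲  e = contradiction e (~⇒≢ {G = G} Z.v~b)
    vertex-injective 𝐳  𝐳  _ = refl
    vertex-injective 𝐳  𝐱′ e = contradiction (sym e) Z′.a≢c
    vertex-injective 𝐳  𝐲′ e = contradiction e Y.b≢c
    vertex-injective 𝐳  𝐳′ e = contradiction e (~⇒≢ {G = G} Z.v~c)
    vertex-injective 𝐱′ 𝐱  e = contradiction (sym e) 𝐱≢𝐱′
    vertex-injective 𝐱′ 𝐲  e = contradiction e Y′.a≢c
    vertex-injective 𝐱′ 𝐳  e = contradiction e Z′.a≢c
    vertex-injective 𝐱′ 𝐱′ _ = refl
    vertex-injective 𝐱′ 𝐲′ e = contradiction e (~⇒≢ {G = G} X′.v~a)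
    vertex-injective 𝐱′ 𝐳′ e = contradiction e (~⇒≢ {G = G} X′.v~b)
    vertex-injective 𝐲′ 𝐱  e = contradiction (sym e) Y.a≢c
    vertex-injective 𝐲′ 𝐲  e = contradiction e (~⇒≢ {G = G} Y′.v~c)
    vertex-injective 𝐲′ 𝐳  e = contradiction (sym e) Y.b≢c
    vertex-injective 𝐲′ 𝐱′ e = contradiction e (~⇒≢ {G = G} Y′.v~a)
    vertex-injective 𝐲′ 𝐲′ _ = refl
    vertex-injective 𝐲′ 𝐳′ e = contradiction e (~⇒≢ {G = G} Y′.v~b)
    vertex-injective 𝐳′ 𝐱  e = contradiction (sym e) Z.a≢c
    vertex-injective 𝐳′ 𝐲  e = contradiction (sym e) Z.b≢c
    vertex-injective 𝐳′ 𝐳  e = contradiction e (~⇒≢ {G = G} Z′.v~c)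
    vertex-injective 𝐳′ 𝐱′ e = contradiction e (~⇒≢ {G = G} Z′.v~a)
    vertex-injective 𝐳′ 𝐲′ e = contradiction e (~⇒≢ {G = G} Z′.v~b)
    vertex-injective 𝐳′ 𝐳′ _ = refl

    vertex-preserves : ∀ a b → blockEdge a b ≡ true → Adj (V a) (V b)
    vertex-preserves 𝐱  𝐲  _ = X.v~a
    vertex-preserves 𝐱  𝐳  _ = X.v~b
    vertex-preserves 𝐲  𝐳  _ = Y.v~b
    vertex-preserves 𝐱′ 𝐲′ _ = X′.v~a
    vertex-preserves 𝐱′ 𝐳′ _ = X′.v~b
    vertex-preserves 𝐲′ 𝐳′ _ = Y′.v~b
    vertex-preserves 𝐲  𝐲′ _ = Y.v~c
    vertex-preserves 𝐳  𝐳′ _ = Z.v~c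

    saturated-𝐲 : ∀ {u} → Adj (V 𝐲) u → u ∈ᴮ B
    saturated-𝐲 e with neighbours (at-y B) e
    ... | inj₁ eq = 𝐱 , eq
    ... | inj₂ (inj₁ eq) = 𝐳 , eq
    ... | inj₂ (inj₂ eq) = 𝐲′ , eq

    saturated-𝐳 : ∀ {u} → Adj (V 𝐳) u → u ∈ᴮ B
    saturated-𝐳 e with neighbours (at-z B) e
    ... | inj₁ eq = 𝐱 , eq
    ... | inj₂ (inj₁ eq) = 𝐲 , eq
    ... | inj₂ (inj₂ eq) = 𝐳′ , eq

    -- A triangle at `𝐱` through `outer` also uses `𝐲` or `𝐳`, whose neighbours all belong to the
    -- block. Concluding membership, not a contradiction, covers the case where `outer` is itself in
    -- the block.
    triangle-𝐱 : ∀ {s t} → Adj (V 𝐱) s → Adj (V 𝐱) t → Adj s t → s ∈ᴮ B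
    triangle-𝐱 x~s x~t s~t with neighbours (at-x B) x~s | neighbours (at-x B) x~t
    ... | inj₁ eq | _ = 𝐲 , eq
    ... | inj₂ (inj₁ eq) | _ = 𝐳 , eq
    ... | inj₂ (inj₂ refl) | inj₁ refl = saturated-𝐲 (~-sym {G = G} s~t)
    ... | inj₂ (inj₂ refl) | inj₂ (inj₁ refl) = saturated-𝐳 (~-sym {G = G} s~t)
    ... | inj₂ (inj₂ refl) | inj₂ (inj₂ refl) = contradiction s~t (~-irrefl {G = G})

  triangle⊆block : ∀ B {v s t} → v ∈ᴮ B → Adj v s → Adj v t → Adj s t → s ∈ᴮ B
  triangle⊆block B (𝐱  , refl) v~s v~t s~t = triangle-𝐱 B v~s v~t s~t
  triangle⊆block B (𝐲  , refl) v~s _ _ = saturated-𝐲 B v~s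
  triangle⊆block B (𝐳  , refl) v~s _ _ = saturated-𝐳 B v~s
  triangle⊆block B (𝐱′ , refl) v~s v~t s~t = ∈flip⁻ B (triangle-𝐱 (flip B) v~s v~t s~t)
  triangle⊆block B (𝐲′ , refl) v~s _ _ = ∈flip⁻ B (saturated-𝐲 (flip B) v~s)
  triangle⊆block B (𝐳′ , refl) v~s _ _ = ∈flip⁻ B (saturated-𝐳 (flip B) v~s)

  module _ (C : Block) where
    private
      U = vertex C
      module X = ThreeNeighbours (at-x C)
      module Y = ThreeNeighbours (at-y C)
      module Z = ThreeNeighbours (at-z C)
      module X′ = ThreeNeighbours (at-x′ C)
      module Y′ = ThreeNeighbours (at-y′ C)
      module Z′ = ThreeNeighbours (at-z′ C)

    -- Up to `flip`, only `𝐱` can have a neighbour outside `B`, so this is the hard case of `cross`.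
    -- If the `𝐳` of `C` is `𝐲` or `𝐳` in `B`, then the `𝐳′` of `C` lies in `B` and brings its
    -- triangle along. Otherwise it takes the outer place, and `𝐲′` must be one of the other two
    -- neighbours.
    cross-𝐱 : ∀ B → U 𝐲 ≡ vertex B 𝐱 → U 𝐲′ ∈ᴮ B
    cross-𝐱 B eq
      with neighbours (at-x B) (subst (λ v → Adj v (U 𝐳)) eq Y.v~b)
         | neighbours (at-x B) (subst (λ v → Adj v (U 𝐲′)) eq Y.v~c)
    ... | inj₁ e | _ = triangle⊆block B
            (saturated-𝐲 B (subst (λ v → Adj v (U 𝐳′)) e Z.v~c)) Z′.v~b Z′.v~a (~-sym {G = G} X′.v~a)
    ... | inj₂ (inj₁ e) | _ = triangle⊆block B
            (saturated-𝐳 B (subst (λ v → Adj v (U 𝐳′)) e Z.v~c)) Z′.v~b Z′.v~a (~-sym {G = G} X′.v~a)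
    ... | inj₂ (inj₂ _) | inj₁ e = 𝐲 , e
    ... | inj₂ (inj₂ _) | inj₂ (inj₁ e) = 𝐳 , e
    ... | inj₂ (inj₂ e) | inj₂ (inj₂ e′) = contradiction (trans e (sym e′)) Y.b≢c

    cross : ∀ B → U 𝐲 ∈ᴮ B → U 𝐲′ ∈ᴮ B
    cross B (𝐱  , eq) = cross-𝐱 B eq
    cross B (𝐲  , eq) = saturated-𝐲 B (subst (λ v → Adj v (U 𝐲′)) eq Y.v~c)
    cross B (𝐳  , eq) = saturated-𝐳 B (subst (λ v → Adj v (U 𝐲′)) eq Y.v~c)
    cross B (𝐱′ , eq) = ∈flip⁻ B (cross-𝐱 (flip B) eq)
    cross B (𝐲′ , eq) = ∈flip⁻ B (saturated-𝐲 (flip B) (subst (λ v → Adj v (U 𝐲′)) eq Y.v~c))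
    cross B (𝐳′ , eq) = ∈flip⁻ B (saturated-𝐳 (flip B) (subst (λ v → Adj v (U 𝐲′)) eq Y.v~c))

    𝐲∈⇒⊆ : ∀ B → U 𝐲 ∈ᴮ B → ∀ c → U c ∈ᴮ B
    𝐲∈⇒⊆ B i 𝐱  = triangle⊆block B i Y.v~a Y.v~b X.v~b
    𝐲∈⇒⊆ B i 𝐲  = i
    𝐲∈⇒⊆ B i 𝐳  = triangle⊆block B i Y.v~b Y.v~a Z.v~a
    𝐲∈⇒⊆ B i 𝐱′ = triangle⊆block B (cross B i) Y′.v~a Y′.v~b X′.v~b
    𝐲∈⇒⊆ B i 𝐲′ = cross B i
    𝐲∈⇒⊆ B i 𝐳′ = triangle⊆block B (cross B i) Y′.v~b Y′.v~a Z′.v~a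

  -- A shared vertex spreads over its triangle, then along the edge from `𝐲` to `𝐲′` to the other
  -- triangle. By symmetry, overlapping blocks have the same vertices.
  overlap⇒⊆ : ∀ C B {v} → v ∈ᴮ C → v ∈ᴮ B → ∀ c → vertex C c ∈ᴮ B
  overlap⇒⊆ C B (a , refl) i = from a i
    where
    from-half : ∀ C → vertex C 𝐱 ∈ᴮ B ⊎ vertex C 𝐲 ∈ᴮ B ⊎ vertex C 𝐳 ∈ᴮ B → ∀ c → vertex C c ∈ᴮ B
    from-half C (inj₁ i) = 𝐲∈⇒⊆ C B (triangle⊆block B i
      (ThreeNeighbours.v~a (at-x C)) (ThreeNeighbours.v~b (at-x C)) (ThreeNeighbours.v~b (at-y C)))
    from-half C (inj₂ (inj₁ i)) = 𝐲∈⇒⊆ C B i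
    from-half C (inj₂ (inj₂ i)) = 𝐲∈⇒⊆ C B (triangle⊆block B i
      (ThreeNeighbours.v~b (at-z C)) (ThreeNeighbours.v~a (at-z C)) (ThreeNeighbours.v~a (at-y C)))

    unflip : (∀ c → vertex (flip C) c ∈ᴮ B) → ∀ c → vertex C c ∈ᴮ B
    unflip all c = subst (λ d → vertex C d ∈ᴮ B) (flipLabel-involutive c) (all (flipLabel c))

    from : ∀ a → vertex C a ∈ᴮ B → ∀ c → vertex C c ∈ᴮ B
    from 𝐱  i = from-half C (inj₁ i)
    from 𝐲  i = from-half C (inj₂ (inj₁ i))
    from 𝐳  i = from-half C (inj₂ (inj₂ i))
    from 𝐱′ i = unflip (from-half (flip C) (inj₁ i))
    from 𝐲′ i = unflip (from-half (flip C) (inj₂ (inj₁ i)))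
    from 𝐳′ i = unflip (from-half (flip C) (inj₂ (inj₂ i)))

  module _ {x y z p q r : Fin n} (tx : ThreeNeighbours G x y z p)
    (ty : ThreeNeighbours G y x z q) (tz : ThreeNeighbours G z x y r) (q~r : Adj q r) where
    private
      module X = ThreeNeighbours tx
      module Y = ThreeNeighbours ty
      module Z = ThreeNeighbours tz

      -- Otherwise the edge from `x` to `y` would lie in two triangles, and `r` would be the tip of
      -- that diamond.
      p≢q : p ≢ q
      p≢q refl = noDiamond tz (swap₁₂ tx) (swap₁₂ ty) (~-sym {G = G} q~r)

      x≁q : ¬ Adj x q
      x≁q x~q with neighbours tx x~q
      ... | inj₁ refl = ~-irrefl {G = G} Y.v~c
      ... | inj₂ (inj₁ refl) = Y.b≢c refl
      ... | inj₂ (inj₂ refl) = p≢q refl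

      z≁q : ¬ Adj z q
      z≁q z~q with neighbours tz z~q
      ... | inj₁ refl = Y.a≢c refl
      ... | inj₂ (inj₁ refl) = ~-irrefl {G = G} Y.v~c
      ... | inj₂ (inj₂ refl) = ~-irrefl {G = G} q~r

      y≁r : ¬ Adj y r
      y≁r y~r with neighbours ty y~r
      ... | inj₁ refl = Z.a≢c refl
      ... | inj₂ (inj₁ refl) = ~-irrefl {G = G} Z.v~c
      ... | inj₂ (inj₂ refl) = ~-irrefl {G = G} q~r

      y≁d : ∀ {d} → Adj q d → ¬ Adj y d
      y≁d q~d y~d with neighbours ty y~d
      ... | inj₁ refl = x≁q (~-sym {G = G} q~d)
      ... | inj₂ (inj₁ refl) = z≁q (~-sym {G = G} q~d)
      ... | inj₂ (inj₂ refl) = ~-irrefl {G = G} q~d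

      -- Some triangle contains `q`. Among its neighbours `y`, `r`, `d` only the last two can be
      -- adjacent, because the neighbours `x` and `z` of `y` are not adjacent to `q`.
      opposite : ∃[ d ] (ThreeNeighbours G q y r d × Adj r d)
      opposite with thirdNeighbour (~-sym {G = G} Y.v~c) q~r Z.b≢c
      ... | d , tq with _~?_ G r d | triangles q
      ... | yes r~d | _ = d , tq , r~d
      ... | no r≁d | s , t , strongTriangle T S _ _ = ⊥-elim
              (noTriangleAt tq y≁r (y≁d (ThreeNeighbours.v~c tq)) r≁d
                (ThreeNeighbours.v~a T) (ThreeNeighbours.v~b T) (ThreeNeighbours.v~b S))

    triangle⇒block : ∃[ B ] (vertex B 𝐱 ≡ x × vertex B 𝐲 ≡ y × vertex B 𝐳 ≡ z)
    triangle⇒block with opposite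
    ... | d , tq , r~d = record
      { vertex = λ { 𝐱 → x ; 𝐲 → y ; 𝐳 → z ; 𝐱′ → d ; 𝐲′ → q ; 𝐳′ → r }
      ; at-x = tx ; at-y = ty ; at-z = tz
      ; at-x′ = proj₂ (thirdNeighbour (~-sym {G = G} Q.v~c) (~-sym {G = G} r~d) (~⇒≢ {G = G} q~r))
      ; at-y′ = swap₁₂ (swap₂₃ (swap₁₂ tq))
      ; at-z′ = threeNeighbours (≢-sym (~⇒≢ {G = G} Q.v~c)) (λ { refl → z≁q (~-sym {G = G} Q.v~c) })
          (≢-sym Y.b≢c) r~d (~-sym {G = G} q~r) (~-sym {G = G} Z.v~c)
      } , refl , refl , refl
      where module Q = ThreeNeighbours tq

  -- The vertex of the triangle whose outer neighbour is not part of the chosen link takes the label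
  -- `𝐱`.
  blockAt : ∀ v → ∃[ B ] (v ≡ vertex B 𝐱 ⊎ v ≡ vertex B 𝐲 ⊎ v ≡ vertex B 𝐳)
  blockAt v with triangles v
  ... | b , c , strongTriangle tv tb tc (inj₁ p~q) =
        let (B , _ , v≡ , _) = triangle⇒block tc (swap₁₂ tv) (swap₁₂ tb) p~q in B , inj₂ (inj₁ (sym v≡))
  ... | b , c , strongTriangle tv tb tc (inj₂ (inj₁ p~r)) =
        let (B , _ , v≡ , _) = triangle⇒block tb tv (swap₁₂ tc) p~r in B , inj₂ (inj₁ (sym v≡))
  ... | b , c , strongTriangle tv tb tc (inj₂ (inj₂ q~r)) =
        let (B , v≡ , _) = triangle⇒block tv tb tc q~r in B , inj₁ (sym v≡)

  -- Successive blocks are joined by links; only the first 𝐱′ and the last 𝐱 have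
  -- their third neighbour unaccounted for.
  record Chain (m : ℕ) : Set where
    field
      block     : Fin (suc m) → Block
      injective : ∀ {i j a b} → vertex (block i) a ≡ vertex (block j) b → (i , a) ≡ (j , b)
      links     : ∀ {i j} → toℕ j ≡ suc (toℕ i) → Adj (vertex (block i) 𝐱) (vertex (block j) 𝐱′)

    Closed : Set
    Closed = Adj (vertex (block (fromℕ m)) 𝐱) (vertex (block zero) 𝐱′)

  module _ {m : ℕ} (chain : Chain m) where
    open Chain chain

    chain-size : suc m ≤ n
    chain-size = injective⇒≤ {f = λ i → vertex (block i) 𝐱} λ eq → cong proj₁ (injective eq)

    closed⇒↪ : Closed → F (suc m) ↪ G
    closed⇒↪ closed = record
      { to        = f
      ; injective = injective
      ; preserves = λ {u} {v} e → [ oriented u v , ~-sym {G = G} ∘ oriented v u ]′ (∨-true⁻ (arc u v) e)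
      }
      where
      f : Fin (suc m) × Label → Fin n
      f (i , a) = vertex (block i) a

      -- Restates the oriented edge relation that is local to `F`.
      arc : Fin (suc m) × Label → Fin (suc m) × Label → Bool
      arc (i , a) (j , b) = (does (i ≟ᶠ j) ∧ blockEdge a b) ∨ (isNext i j ∧ linkEdge a b)

      link : ∀ i j → isNext i j ≡ true → Adj (f (i , 𝐱)) (f (j , 𝐱′))
      link i j e with isNext⁻ {i = i} {j} e
      ... | inj₁ eq = links eq
      ... | inj₂ (refl , refl) = closed

      oriented : ∀ u v → arc u v ≡ true → Adj (f u) (f v)
      oriented (i , a) (j , b) e with ∨-true⁻ (does (i ≟ᶠ j) ∧ blockEdge a b) e
      ... | inj₁ e₁ with ∧-true⁻ (does (i ≟ᶠ j)) e₁
      ...   | i≡j , ab with does-true⁻ (i ≟ᶠ j) i≡j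
      ...     | refl = vertex-preserves (block i) a b ab
      oriented (i , a) (j , b) e | inj₂ e₂ with ∧-true⁻ (isNext i j) e₂
      ...   | ij , ab with linkEdge⁻ a b ab
      ...     | refl , refl = link i j ij

    private
      first = block zero
      p     = outer′ first

      x′~p : Adj (vertex first 𝐱′) p
      x′~p = ThreeNeighbours.v~c (at-x′ first)

    -- `p` is adjacent to the first `𝐱′`, while every other chain vertex except the last `𝐱` has its
    -- three neighbours accounted for: within the block for `𝐲`, `𝐳`, `𝐲′`, `𝐳′`, and by a link for
    -- the inner `𝐱` and `𝐱′`. So the last `𝐱` is the only place in the chain where `p` could be.
    fresh : vertex (block (fromℕ m)) 𝐱 ≢ p → ∀ i a → p ≢ vertex (block i) a
    fresh open′ i a eq = case i a (subst (λ v → Adj v (vertex first 𝐱′)) eq (~-sym {G = G} x′~p)) eq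
      where
      case : ∀ i a → Adj (vertex (block i) a) (vertex first 𝐱′) → p ≢ vertex (block i) a
      case i 𝐲 e eq with neighbours (at-y (block i)) e
      ... | inj₁ e′        with () ← injective e′
      ... | inj₂ (inj₁ e′) with () ← injective e′
      ... | inj₂ (inj₂ e′) with () ← injective e′
      case i 𝐳 e eq with neighbours (at-z (block i)) e
      ... | inj₁ e′        with () ← injective e′
      ... | inj₂ (inj₁ e′) with () ← injective e′
      ... | inj₂ (inj₂ e′) with () ← injective e′
      case i 𝐲′ e eq with neighbours (at-y′ (block i)) e
      ... | inj₁ e′        with refl ← injective e′ = ThreeNeighbours.a≢c (at-x′ first) (sym eq)
      ... | inj₂ (inj₁ e′) with () ← injective e′
      ... | inj₂ (inj₂ e′) with () ← injective e′
      case i 𝐳′ e eq with neighbours (at-z′ (block i)) e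
      ... | inj₁ e′        with refl ← injective e′ = ThreeNeighbours.b≢c (at-x′ first) (sym eq)
      ... | inj₂ (inj₁ e′) with () ← injective e′
      ... | inj₂ (inj₂ e′) with () ← injective e′
      case zero 𝐱′ e eq = ~-irrefl {G = G} e
      case (suc i) 𝐱′ e eq
        with neighbours (at-x′ (block (suc i))) e
           | neighbours (at-x′ (block (suc i)))
               (~-sym {G = G} (links {inject₁ i} {suc i} (cong suc (sym (toℕ-inject₁ i)))))
      ... | inj₁ e′        | _ with () ← injective e′
      ... | inj₂ (inj₁ e′) | _ with () ← injective e′
      ... | inj₂ (inj₂ _)  | inj₁ e″ with () ← injective e″
      ... | inj₂ (inj₂ _)  | inj₂ (inj₁ e″) with () ← injective e″
      ... | inj₂ (inj₂ e′) | inj₂ (inj₂ e″) with () ← injective (trans e′ (sym e″))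
      case i 𝐱 e eq with view i
      ... | ‵fromℕ = open′ (sym eq)
      ... | ‵inject₁ j
        with neighbours (at-x (block (inject₁ j))) e
           | neighbours (at-x (block (inject₁ j))) (links {inject₁ j} {suc j} (cong suc (sym (toℕ-inject₁ j))))
      ... | inj₁ e′        | _ with () ← injective e′
      ... | inj₂ (inj₁ e′) | _ with () ← injective e′
      ... | inj₂ (inj₂ _)  | inj₁ e″ with () ← injective e″
      ... | inj₂ (inj₂ _)  | inj₂ (inj₁ e″) with () ← injective e″
      ... | inj₂ (inj₂ e′) | inj₂ (inj₂ e″) with () ← injective (trans e′ (sym e″))

    module _ (open′ : vertex (block (fromℕ m)) 𝐱 ≢ p) where

      -- If the block of `p` met the chain, it would be contained in a chain block, and `p` with it.
      disjointFrom : ∀ C → p ∈ᴮ C → ∀ {i a b} → vertex C a ≢ vertex (block i) b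
      disjointFrom C (c , p≡) {i} {a} {b} eq =
        let (d , e) = overlap⇒⊆ C (block i) (a , refl) (b , eq) c in fresh open′ i d (trans p≡ e)

      -- At `𝐲` or `𝐳` all neighbours of `p` would belong to its block, including the first `𝐱′`,
      -- which is in the chain.
      newBlock : ∃[ C ] p ≡ vertex C 𝐱
      newBlock with blockAt p
      ... | C , inj₁ p≡x = C , p≡x
      ... | C , inj₂ (inj₁ eq) = ⊥-elim (disjointFrom C (𝐲 , eq)
              (sym (proj₂ (saturated-𝐲 C (subst (λ v → Adj v (vertex first 𝐱′)) eq (~-sym {G = G} x′~p))))))
      ... | C , inj₂ (inj₂ eq) = ⊥-elim (disjointFrom C (𝐳 , eq)
              (sym (proj₂ (saturated-𝐳 C (subst (λ v → Adj v (vertex first 𝐱′)) eq (~-sym {G = G} x′~p))))))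

      -- Prepending leaves the last block in place, so the end that must eventually be met does not
      -- move.
      extendChain : Chain (suc m)
      extendChain with newBlock
      ... | C , p≡x = record
        { block     = C ◂ block
        ; injective = λ
            { {zero}  {zero}  {a} {b} eq → cong (zero ,_) (vertex-injective C a b eq)
            ; {zero}  {suc j} eq → ⊥-elim (disjointFrom C (𝐱 , p≡x) eq)
            ; {suc i} {zero}  eq → ⊥-elim (disjointFrom C (𝐱 , p≡x) (sym eq))
            ; {suc i} {suc j} eq → cong (λ (k , a) → suc k , a) (injective eq) }
        ; links     = λ
            { {zero}  {suc zero} _ → subst (λ v → Adj v (vertex first 𝐱′)) p≡x (~-sym {G = G} x′~p)
            ; {suc i} {suc j} eq → links (suc-injective eq) }
        }

    advance : Closed ⊎ Chain (suc m)
    advance with vertex (block (fromℕ m)) 𝐱 ≟ᶠ p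
    ... | yes eq = inj₁ (subst (λ v → Adj v (vertex first 𝐱′)) (sym eq) (~-sym {G = G} x′~p))
    ... | no open′ = inj₂ (extendChain open′)

  -- The fuel `k` is `n ∸ m`. When it is exhausted, the chain would have `n + 1` blocks and as many
  -- distinct vertices `𝐱`.
  closeChain : ∀ k {m} → k + m ≡ n → Chain m → ∃[ l ] Σ[ c ∈ Chain l ] Chain.Closed c
  closeChain zero    refl c = contradiction (chain-size c) 1+n≰n
  closeChain (suc k) eq   c with advance c
  ... | inj₁ closed = _ , c , closed
  ... | inj₂ c′ = closeChain k (trans (+-suc k _) eq) c′

  singleton : Block → Chain 0
  singleton B = record
    { block     = λ _ → B
    ; injective = λ { {zero} {zero} {a} {b} eq → cong (zero ,_) (vertex-injective B a b eq) }
    ; links     = λ { {zero} {zero} () }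
    }

  F↪ : Fin n → ∃[ m ] F (suc m) ↪ G
  F↪ v with closeChain n (+-identityʳ n) (singleton (proj₁ (blockAt v)))
  ... | m , c , closed = m , closed⇒↪ c closed

-- Assembling the classification

∀⊎⇒∃⊎∀ : ∀ {n} {A B : Fin n → Set} → (∀ v → A v ⊎ B v) → (∃[ v ] A v) ⊎ (∀ v → B v)
∀⊎⇒∃⊎∀ {zero}  f = inj₂ λ ()
∀⊎⇒∃⊎∀ {suc n} f with f zero | ∀⊎⇒∃⊎∀ (f ∘ suc)
... | inj₁ a | _ = inj₁ (zero , a)
... | inj₂ _ | inj₁ (v , a) = inj₁ (suc v , a)
... | inj₂ b | inj₂ bs = inj₂ λ { zero → b ; (suc v) → bs v }

module _ {n : ℕ} (G : Graph (Fin n)) (cubic : Cubic G) where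
  open Graph G

  strongEdge⇒K₃,₃↪ : ∀ {v u} → StrongEdge G v u → K₃,₃ ↪ G
  strongEdge⇒K₃,₃↪ {v} {u} e =
    record { to = f ; injective = f-injective _ _ ; preserves = λ {x} {y} → f-preserves x y }
    where
    open StrongEdge e
    open Bipartite G cubic e
    even odd : Fin 3 → Fin n
    even = v ◂ b₁ ◂ b₂ ◂ λ ()
    odd = u ◂ a₁ ◂ a₂ ◂ λ ()
    f : Fin 3 ⊎ Fin 3 → Fin n
    f = [ even , odd ]′

    isEven : ∀ i → Even (even i)
    isEven 0F = around-v
    isEven 1F = b₁-even
    isEven 2F = b₂-even

    isOdd : ∀ j → Odd (odd j)
    isOdd 0F = around-u
    isOdd 1F = a₁-odd
    isOdd 2F = a₂-odd

    even~odd : ∀ i j → Adj (even i) (odd j)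
    even~odd i 0F = ThreeNeighbours.v~a (isEven i)
    even~odd i 1F = ThreeNeighbours.v~b (isEven i)
    even~odd i 2F = ThreeNeighbours.v~c (isEven i)

    distinct⇒injective : ∀ {a b c : Fin n} → a ≢ b → a ≢ c → b ≢ c → ∀ i j →
      (a ◂ b ◂ c ◂ λ ()) i ≡ (a ◂ b ◂ c ◂ λ ()) j → i ≡ j
    distinct⇒injective ab ac bc 0F 0F _ = refl
    distinct⇒injective ab ac bc 0F 1F e = contradiction e ab
    distinct⇒injective ab ac bc 0F 2F e = contradiction e ac
    distinct⇒injective ab ac bc 1F 0F e = contradiction (sym e) ab
    distinct⇒injective ab ac bc 1F 1F _ = refl
    distinct⇒injective ab ac bc 1F 2F e = contradiction e bc
    distinct⇒injective ab ac bc 2F 0F e = contradiction (sym e) ac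
    distinct⇒injective ab ac bc 2F 1F e = contradiction (sym e) bc
    distinct⇒injective ab ac bc 2F 2F _ = refl

    f-injective : ∀ x y → f x ≡ f y → x ≡ y
    f-injective (inj₁ i) (inj₁ j) eq = cong inj₁ (distinct⇒injective T.a≢b T.a≢c T.b≢c i j eq)
      where module T = ThreeNeighbours around-u
    f-injective (inj₂ i) (inj₂ j) eq = cong inj₂ (distinct⇒injective T.a≢b T.a≢c T.b≢c i j eq)
      where module T = ThreeNeighbours around-v
    f-injective (inj₁ i) (inj₂ j) eq = ⊥-elim (even⇒¬odd (isEven i) (subst Odd (sym eq) (isOdd j)))
    f-injective (inj₂ i) (inj₁ j) eq = ⊥-elim (even⇒¬odd (isEven j) (subst Odd eq (isOdd i)))

    f-preserves : ∀ x y → Graph.Adj K₃,₃ x y → Adj (f x) (f y)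
    f-preserves (inj₁ i) (inj₂ j) _ = even~odd i j
    f-preserves (inj₂ i) (inj₁ j) _ = ~-sym {G = G} (even~odd j i)

  tetrahedron⇒K₄↪ : ∀ {v a b c} → Tetrahedron G v a b c → K₄ ↪ G
  tetrahedron⇒K₄↪ {v} {a} {b} {c} (tetrahedron t a~b a~c b~c) =
    record { to = f ; injective = f-injective _ _ ; preserves = λ {x} {y} → f-preserves x y ∘ distinct⁻ x y }
    where
    module T = ThreeNeighbours t
    f : Fin 4 → Fin n
    f = v ◂ a ◂ b ◂ c ◂ λ ()

    distinct⁻ : ∀ (x y : Fin 4) → Graph.Adj K₄ x y → x ≢ y
    distinct⁻ x x e refl = ~-irrefl {G = K₄} {x} e

    f-preserves : ∀ x y → x ≢ y → Adj (f x) (f y)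
    f-preserves 0F 0F x≢y = contradiction refl x≢y
    f-preserves 0F 1F _ = T.v~a
    f-preserves 0F 2F _ = T.v~b
    f-preserves 0F 3F _ = T.v~c
    f-preserves 1F 0F _ = ~-sym {G = G} T.v~a
    f-preserves 1F 1F x≢y = contradiction refl x≢y
    f-preserves 1F 2F _ = a~b
    f-preserves 1F 3F _ = a~c
    f-preserves 2F 0F _ = ~-sym {G = G} T.v~b
    f-preserves 2F 1F _ = ~-sym {G = G} a~b
    f-preserves 2F 2F x≢y = contradiction refl x≢y
    f-preserves 2F 3F _ = b~c
    f-preserves 3F 0F _ = ~-sym {G = G} T.v~c
    f-preserves 3F 1F _ = ~-sym {G = G} a~c
    f-preserves 3F 2F _ = ~-sym {G = G} b~c
    f-preserves 3F 3F x≢y = contradiction refl x≢y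

    f-injective : ∀ x y → f x ≡ f y → x ≡ y
    f-injective x y eq with x ≟ᶠ y
    ... | yes x≡y = x≡y
    ... | no x≢y = contradiction eq (~⇒≢ {G = G} (f-preserves x y x≢y))

Listed : ∀ {n} → Graph (Fin n) → Set
Listed G = G ≅ K₃,₃ ⊎ G ≅ K₄ ⊎ G ≅ C₆-complement ⊎ (∃[ m ] (2 ≤ m × G ≅ F m))

listed⇒locallyStrong : ∀ {n} {G : Graph (Fin n)} → Listed G → ∀ v → LocallyStrong G v
listed⇒locallyStrong (inj₁ iso) = ≅-locallyStrong iso K₃,₃-locallyStrong
listed⇒locallyStrong (inj₂ (inj₁ iso)) = ≅-locallyStrong iso K₄-locallyStrong
listed⇒locallyStrong (inj₂ (inj₂ (inj₁ iso))) = ≅-locallyStrong iso C₆-complement-locallyStrong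
listed⇒locallyStrong (inj₂ (inj₂ (inj₂ (suc m , _ , iso)))) = ≅-locallyStrong iso F-locallyStrong

-- One strong edge or one `K₄` anywhere already determines a connected graph. Splitting these cases
-- off leaves a strong triangle at every vertex, which is what `Blocks` requires.
locallyStrong⇒listed : ∀ {n} (G : Graph (Fin n)) → Connected G → Cubic G →
  (∀ v → LocallyStrong G v) → Listed G
locallyStrong⇒listed G connected cubic local = edgesFirst (∀⊎⇒∃⊎∀ local)
  where
  embedding⇒≅ : ∀ {W : Set} {H : Graph W} → (∀ w → LocallyStrong H w) → W → H ↪ G → G ≅ H
  embedding⇒≅ local = ↪⇒≅ G connected cubic (locallyStrong⇒threeNeighbours ∘ local)

  Triangle Tetra : Fin _ → Set
  Triangle v = ∃[ b ] ∃[ c ] StrongTriangle G v b c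
  Tetra v = ∃[ a ] ∃[ b ] ∃[ c ] Tetrahedron G v a b c

  blocks : ∃[ m ] F (suc m) ↪ G → Listed G
  blocks (zero , emb) = inj₂ (inj₂ (inj₁
    (embedding⇒≅ C₆-complement-locallyStrong 0F (↪-trans (≅⇒↪ C₆-complement≅F₁) emb))))
  blocks (suc m , emb) = inj₂ (inj₂ (inj₂
    (2 + m , s≤s (s≤s z≤n) , embedding⇒≅ F-locallyStrong (0F , 𝐱) emb)))

  tetrahedraFirst : (∃[ v ] Tetra v) ⊎ (∀ v → Triangle v) → Listed G
  tetrahedraFirst (inj₁ (_ , _ , _ , _ , t)) =
    inj₂ (inj₁ (embedding⇒≅ K₄-locallyStrong 0F (tetrahedron⇒K₄↪ G cubic t)))
  tetrahedraFirst (inj₂ triangles) = blocks (Blocks.F↪ G cubic triangles (fromℕ< (proj₁ connected)))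

  edgesFirst : (∃[ v ] ∃[ u ] StrongEdge G v u) ⊎ (∀ v → Triangle v ⊎ Tetra v) → Listed G
  edgesFirst (inj₁ (_ , _ , e)) =
    inj₁ (embedding⇒≅ K₃,₃-locallyStrong (inj₁ 0F) (strongEdge⇒K₃,₃↪ G cubic e))
  edgesFirst (inj₂ local′) = tetrahedraFirst (∀⊎⇒∃⊎∀ (swap ∘ local′))

-- Deciding first-order properties on the random access machine

data Formula : ℕ → Set where
  edgeᶠ sameᶠ : ∀ {k} → Fin k → Fin k → Formula k
  ¬ᶠ_ : ∀ {k} → Formula k → Formula k
  _∧ᶠ_ _∨ᶠ_ : ∀ {k} → Formula k → Formula k → Formula k
  ∀ᶠ ∃ᶠ : ∀ {k} → Formula (suc k) → Formula k

infix  7 ¬ᶠ_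
infixr 6 _∧ᶠ_
infixr 5 _∨ᶠ_

module _ {V : Set} (G : Graph V) where
  Sat : ∀ {k} → Formula k → Vec V k → Set
  Sat (edgeᶠ i j) ρ = Graph.Adj G (lookup ρ i) (lookup ρ j)
  Sat (sameᶠ i j) ρ = lookup ρ i ≡ lookup ρ j
  Sat (¬ᶠ φ)    ρ = ¬ Sat φ ρ
  Sat (φ ∧ᶠ ψ)  ρ = Sat φ ρ × Sat ψ ρ
  Sat (φ ∨ᶠ ψ)   ρ = Sat φ ρ ⊎ Sat ψ ρ
  Sat (∀ᶠ φ)    ρ = ∀ v → Sat φ (v ∷ ρ)
  Sat (∃ᶠ φ)     ρ = ∃[ v ] Sat φ (v ∷ ρ)

-- Disjunction and existence are compiled through De Morgan duality; decidability removes the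
-- resulting double negation.
sat? : ∀ {n k} (G : Graph (Fin n)) (φ : Formula k) ρ → Dec (Sat G φ ρ)
sat? G (edgeᶠ i j) ρ = Graph.adj G (lookup ρ i) (lookup ρ j) ≟ᵇ true
sat? G (sameᶠ i j) ρ = lookup ρ i ≟ᶠ lookup ρ j
sat? G (¬ᶠ φ)    ρ = ¬? (sat? G φ ρ)
sat? G (φ ∧ᶠ ψ)  ρ = sat? G φ ρ ×-dec sat? G ψ ρ
sat? G (φ ∨ᶠ ψ)   ρ = sat? G φ ρ ⊎-dec sat? G ψ ρ
sat? G (∀ᶠ φ)    ρ = all? λ v → sat? G φ (v ∷ ρ)
sat? G (∃ᶠ φ)     ρ = any? λ v → sat? G φ (v ∷ ρ)

-- Cell 0 keeps the number of vertices, cell 1 receives truth values, cell 2 is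
-- scratch, and the variable bound under k others lives in cell 3 + k.
level : ∀ {k} → Fin k → ℕ
level {suc k} zero    = k
level {suc k} (suc i) = level i

level<k : ∀ {k} (i : Fin k) → level i < k
level<k {suc k} zero    = ≤-refl
level<k {suc k} (suc i) = m<n⇒m<1+n (level<k i)

cell : ∀ {k} → Fin k → Address
cell i = 3 + level i

negP : Program → Program
negP p = p ⨾ instr (const 2 1) ⨾ instr (sub 1 2 1)

andP : Program → Program → Program
andP p q = p ⨾ ifNZ 1 q (instr (const 1 0))

-- Cell `3 + k` counts down and holds the vertex under test. As `p` may overwrite cell 2, the loop
-- guard is rebuilt afterwards: a copy of the counter after success, 0 to leave at the first
-- failure.
allBody : ℕ → Program → Program
allBody k p =
  instr (const 2 1) ⨾ instr (sub (3 + k) (3 + k) 2) ⨾ p ⨾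
  ifNZ 1 (instr (const 2 0) ⨾ instr (add 2 (3 + k) 2)) (instr (const 2 0))

allP : ℕ → Program → Program
allP k p =
  -- Copying is done by adding a zeroed cell 2. Cell 1 starts at 1, the verdict for an empty range.
  instr (const 2 0) ⨾ instr (add (3 + k) 0 2) ⨾ instr (add 2 0 2) ⨾ instr (const 1 1) ⨾
  whileNZ 2 (allBody k p)

compile : ∀ {k} → Formula k → Program
compile (edgeᶠ i j) = instr (query 1 (cell i) (cell j))
compile (sameᶠ i j) =
  -- The two truncated differences sum to the distance `d` of the indices, and `1 ∸ d` is 1 exactly
  -- when they agree.
  instr (sub 1 (cell i) (cell j)) ⨾ instr (sub 2 (cell j) (cell i)) ⨾
  instr (add 1 1 2) ⨾ instr (const 2 1) ⨾ instr (sub 1 2 1)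
compile (¬ᶠ φ)    = negP (compile φ)
compile (φ ∧ᶠ ψ)  = andP (compile φ) (compile ψ)
compile (φ ∨ᶠ ψ)   = negP (andP (negP (compile φ)) (negP (compile ψ)))
compile {k} (∀ᶠ φ) = allP k (compile φ)
compile {k} (∃ᶠ φ)  = negP (allP k (negP (compile φ)))

negT : ℕ → ℕ
negT s = s + 2

-- The 2 pays for the branch and for the constant written when the second program is skipped.
andT : ℕ → ℕ → ℕ
andT s t = s + (2 + t)

-- Four instructions of set-up and the final loop test give 5. A round costs `t` plus the loop test,
-- two instructions before `p`, the branch and at most two instructions after it.
allT : ℕ → ℕ → ℕ
allT n t = 5 + n * (6 + t)

time : ∀ {k} → Formula k → ℕ → ℕ
time (edgeᶠ _ _) n = 1
time (sameᶠ _ _) n = 5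
time (¬ᶠ φ)    n = negT (time φ n)
time (φ ∧ᶠ ψ)  n = andT (time φ n) (time ψ n)
time (φ ∨ᶠ ψ)   n = negT (andT (negT (time φ n)) (negT (time ψ n)))
time (∀ᶠ φ)    n = allT n (time φ n)
time (∃ᶠ φ)     n = negT (allT n (negT (time φ n)))

-- Correctness and running time of the compiled programs

Verdict : ℕ → Set → Set
Verdict r P = (r ≡ 1 × P) ⊎ (r ≡ 0 × ¬ P)

verdict-map : ∀ {r P Q} → (P → Q) → (Q → P) → Verdict r P → Verdict r Q
verdict-map f g (inj₁ (r≡1 , p)) = inj₁ (r≡1 , f p)
verdict-map f g (inj₂ (r≡0 , ¬p)) = inj₂ (r≡0 , ¬p ∘ g)

[a∸b]+[b∸a]≡0⇒a≡b : ∀ a b → (a ∸ b) + (b ∸ a) ≡ 0 → a ≡ b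
[a∸b]+[b∸a]≡0⇒a≡b a b eq = ≤-antisym (m∸n≡0⇒m≤n (m+n≡0⇒m≡0 (a ∸ b) eq)) (m∸n≡0⇒m≤n (m+n≡0⇒n≡0 (a ∸ b) eq))

same-verdict : ∀ a b → Verdict (1 ∸ ((a ∸ b) + (b ∸ a))) (a ≡ b)
same-verdict a b with (a ∸ b) + (b ∸ a) in eq
... | zero = inj₁ (refl , [a∸b]+[b∸a]≡0⇒a≡b a b eq)
... | suc d = inj₂ (0∸n≡0 d , λ { refl → contradiction (trans (sym eq) (cong₂ _+_ (n∸n≡0 a) (n∸n≡0 a))) λ () })

update-≢ : ∀ (M : Memory) {a b v} → b ≢ a → (M [ a ↦ v ]) b ≡ M b
update-≢ M {a} {b} b≢a rewrite dec-false (b ≟ⁿ a) b≢a = refl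

update-≡ : ∀ (M : Memory) a {v} → (M [ a ↦ v ]) a ≡ v
update-≡ M a rewrite dec-true (a ≟ⁿ a) refl = refl

module _ {n : ℕ} (G : Graph (Fin n)) where

  matrixEntry-toℕ : ∀ u v → matrixEntry G (toℕ u) (toℕ v) ≡ (if Graph.adj G u v then 1 else 0)
  matrixEntry-toℕ u v with toℕ u <? n | toℕ v <? n
  ... | yes p | yes q = cong₂ (λ a b → if Graph.adj G a b then 1 else 0) (fromℕ<-toℕ u p) (fromℕ<-toℕ v q)
  ... | no ¬p | _ = contradiction (toℕ<n u) ¬p
  ... | yes _ | no ¬q = contradiction (toℕ<n v) ¬q

  -- Cells 1, 2 and those from `3 + k` on are left unspecified, so subprograms are free to overwrite
  -- them.
  record Env {k : ℕ} (M : Memory) (ρ : Vec (Fin n) k) : Set where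
    constructor env
    field
      order     : M 0 ≡ n
      variables : ∀ i → M (cell i) ≡ toℕ (lookup ρ i)

  record Result {k : ℕ} (p : Program) (M : Memory) (τ : ℕ) (ρ : Vec (Fin n) k) (P : Set) : Set where
    constructor result
    field
      {steps}  : ℕ
      {memory} : Memory
      run      : Runs G p M steps memory
      bound    : steps ≤ τ
      kept     : Env memory ρ
      verdict  : Verdict (memory 1) P

  Decides : ∀ {k} → Program → ℕ → Vec (Fin n) k → Set → Set
  Decides p τ ρ P = ∀ M → Env M ρ → Result p M τ ρ P

  decides-map : ∀ {k p τ P Q} {ρ : Vec (Fin n) k} → (P → Q) → (Q → P) → Decides p τ ρ P → Decides p τ ρ Q
  decides-map f g d M e with d M e
  ... | result run bound kept v = result run bound kept (verdict-map f g v)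

  module _ {k : ℕ} {ρ : Vec (Fin n) k} where

    negP-correct : ∀ {p τ P} → Decides p τ ρ P → Decides (negP p) (negT τ) ρ (¬ P)
    negP-correct d M e with d M e
    ... | result {memory = M′} run bound (env o vs) v =
          -- Writes to cells 1 and 2 compute away at cell 0 and at every cell `3 + _`, so the
          -- environment is reused unchanged.
          result (seq run (seq instr instr)) (+-monoˡ-≤ 2 bound) (env o vs) (flip v)
      where
      flip : ∀ {r P} → Verdict r P → Verdict (1 ∸ r) (¬ P)
      flip (inj₁ (refl , p)) = inj₂ (refl , λ ¬p → ¬p p)
      flip (inj₂ (refl , ¬p)) = inj₁ (refl , ¬p)

    andP-correct : ∀ {p q σ τ P Q} → Decides p σ ρ P → Decides q τ ρ Q →
      Decides (andP p q) (andT σ τ) ρ (P × Q)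
    andP-correct dp dq M e with dp M e
    ... | result run bound (env o vs) (inj₂ (r≡0 , ¬p)) =
          result (seq run (if-else r≡0 instr)) (+-mono-≤ bound (m≤m+n 2 _)) (env o vs)
            (inj₂ (refl , ¬p ∘ proj₁))
    ... | result {memory = M′} run bound e′ (inj₁ (r≡1 , p)) with dq M′ e′
    ... | result run′ bound′ e″ v =
          result (seq run (if-then (λ r≡0 → contradiction (trans (sym r≡1) r≡0) λ ()) run′))
            (+-mono-≤ bound (s≤s (m≤n⇒m≤1+n bound′))) e″ (verdict-map (p ,_) proj₂ v)

    module _ {p : Program} {τ : ℕ} {P : Fin n → Set} (d : ∀ v → Decides p τ (v ∷ ρ) (P v)) where

      allBelow-suc : ∀ {j} (j<n : j < n) → P (fromℕ< j<n) → (∀ v → toℕ v < j → P v) →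
        ∀ v → toℕ v < suc j → P v
      allBelow-suc {j} j<n p ps v v<1+j with m≤n⇒m<n∨m≡n (s≤s⁻¹ v<1+j)
      ... | inj₁ v<j = ps v v<j
      ... | inj₂ v≡j = subst P (toℕ-injective (trans (toℕ-fromℕ< j<n) (sym v≡j))) p

      -- Vertices are tested in decreasing order, so those still to be tested are the ones below
      -- `j`. A further round is reached only if every test so far succeeded, hence the 1 in cell 1.
      loop : ∀ j → j ≤ n → ∀ M → Env M ρ → M (3 + k) ≡ j → M 2 ≡ j → M 1 ≡ 1 →
        Result (whileNZ 2 (allBody k p)) M (1 + j * (6 + τ)) ρ (∀ v → toℕ v < j → P v)
      loop zero _ M e _ M₂≡ M₁≡ = result (while-stop M₂≡) ≤-refl e (inj₁ (M₁≡ , λ _ ()))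
      loop (suc j) j<n M (env o vs) Mₓ≡ M₂≡ M₁≡ with d v₀ M″ e″
        where
        v₀ = fromℕ< j<n
        M′ = M [ 2 ↦ 1 ]
        M″ = M′ [ 3 + k ↦ M (3 + k) ∸ 1 ]
        vs″ : ∀ i → M″ (cell i) ≡ toℕ (lookup (v₀ ∷ ρ) i)
        vs″ zero = trans (update-≡ M′ (3 + k)) (trans (cong (_∸ 1) Mₓ≡) (sym (toℕ-fromℕ< j<n)))
        vs″ (suc i) = trans (update-≢ M′ (<⇒≢ (s≤s (s≤s (s≤s (level<k i)))))) (vs i)
        e″ : Env M″ (v₀ ∷ ρ)
        e″ = env o vs″
      ... | result {s} run bound (env o‴ vs‴) (inj₂ (r≡0 , ¬p)) =
            result
              (while-step (λ M₂≡0 → contradiction (trans (sym M₂≡) M₂≡0) λ ())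
                (seq instr (seq instr (seq run (if-else r≡0 instr)))) (while-stop refl))
              (time-stop bound)
              (env o‴ (vs‴ ∘ suc))
              (inj₂ (r≡0 , λ all → ¬p (all (fromℕ< j<n) (s≤s (≤-reflexive (toℕ-fromℕ< j<n))))))
        where
        time-stop : s ≤ τ → suc (2 + (s + 2) + 1) ≤ 1 + suc j * (6 + τ)
        time-stop s≤τ = begin
          3 + (s + 2 + 1)            ≡⟨ cong (3 +_) (trans (+-assoc s 2 1) (+-comm s 3)) ⟩
          6 + s                      ≤⟨ +-monoʳ-≤ 6 s≤τ ⟩
          6 + τ                      ≤⟨ m≤m+n (6 + τ) (j * (6 + τ)) ⟩
          suc j * (6 + τ)            ≤⟨ n≤1+n _ ⟩
          1 + suc j * (6 + τ)        ∎
          where open ≤-Reasoning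
      ... | result {s} {M‴} run bound (env o‴ vs‴) (inj₁ (r≡1 , p))
        with loop j (<⇒≤ j<n) (M‴ [ 2 ↦ 0 ] [ 2 ↦ M‴ (3 + k) + 0 ]) (env o‴ (vs‴ ∘ suc)) x≡j
               (trans (+-identityʳ _) x≡j) r≡1
        where
        x≡j : M‴ (3 + k) ≡ j
        x≡j = trans (vs‴ zero) (toℕ-fromℕ< j<n)
      ... | result {t} run′ bound′ e⁗ v =
            result
              (while-step (λ M₂≡0 → contradiction (trans (sym M₂≡) M₂≡0) λ ())
                (seq instr (seq instr (seq run (if-then (λ r≡0 → contradiction (trans (sym r≡1) r≡0) λ ())
                  (seq instr instr))))) run′)
              (time-step bound bound′)
              e⁗
              (verdict-map (allBelow-suc j<n p) (λ all v v<j → all v (m<n⇒m<1+n v<j)) v)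
        where
        time-step : s ≤ τ → t ≤ 1 + j * (6 + τ) → suc (2 + (s + 3) + t) ≤ 1 + suc j * (6 + τ)
        time-step s≤τ t≤ = begin
          3 + (s + 3 + t)              ≡⟨ cong (λ r → 3 + (r + t)) (+-comm s 3) ⟩
          6 + (s + t)                  ≤⟨ +-monoʳ-≤ 6 (+-mono-≤ s≤τ t≤) ⟩
          6 + (τ + (1 + j * (6 + τ)))  ≡⟨ cong (6 +_) (+-suc τ (j * (6 + τ))) ⟩
          1 + suc j * (6 + τ)          ∎
          where open ≤-Reasoning

      allP-correct : Decides (allP k p) (allT n τ) ρ (∀ v → P v)
      allP-correct M (env o vs)
        with loop n ≤-refl _ (env o vs′)
               (trans (update-≡ (M [ 2 ↦ 0 ]) (3 + k)) M₀+0≡n) M₀+0≡n refl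
        where
        M₀+0≡n : M 0 + 0 ≡ n
        M₀+0≡n = trans (+-identityʳ _) o
        vs′ : ∀ i → (M [ 2 ↦ 0 ] [ 3 + k ↦ M 0 + 0 ]) (cell i) ≡ toℕ (lookup ρ i)
        vs′ i = trans (update-≢ (M [ 2 ↦ 0 ]) (<⇒≢ (s≤s (s≤s (s≤s (level<k i)))))) (vs i)
      ... | result run bound e v = result (seq instr (seq instr (seq instr (seq instr run))))
            (+-monoʳ-≤ 4 bound) e (verdict-map (λ all v → all v (toℕ<n v)) (λ all v _ → all v) v)

  compile-correct : ∀ {k} (φ : Formula k) (ρ : Vec (Fin n) k) →
    Decides (compile φ) (time φ n) ρ (Sat G φ ρ)
  compile-correct (edgeᶠ i j) ρ M (env o vs) = result instr ≤-refl (env o vs)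
    (subst (λ r → Verdict r (Sat G (edgeᶠ i j) ρ))
      (sym (trans (cong₂ (matrixEntry G) (vs i) (vs j)) (matrixEntry-toℕ _ _))) (bool (Graph.adj G _ _)))
    where
    bool : ∀ b → Verdict (if b then 1 else 0) (b ≡ true)
    bool true  = inj₁ (refl , refl)
    bool false = inj₂ (refl , λ ())
  compile-correct (sameᶠ i j) ρ M (env o vs) =
    result (seq instr (seq instr (seq instr (seq instr instr)))) ≤-refl (env o vs)
      (verdict-map (λ eq → toℕ-injective (trans (sym (vs i)) (trans eq (vs j))))
                   (λ eq → trans (vs i) (trans (cong toℕ eq) (sym (vs j))))
                   (same-verdict (M (cell i)) (M (cell j))))
  compile-correct (¬ᶠ φ) ρ = negP-correct (compile-correct φ ρ)
  compile-correct (φ ∧ᶠ ψ) ρ = andP-correct (compile-correct φ ρ) (compile-correct ψ ρ)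
  compile-correct (φ ∨ᶠ ψ) ρ = decides-map
    (λ h → decidable-stable (sat? G (φ ∨ᶠ ψ) ρ) λ ¬or → h (¬or ∘ inj₁ , ¬or ∘ inj₂))
    (λ h (¬φ , ¬ψ) → [ ¬φ , ¬ψ ]′ h)
    (negP-correct (andP-correct (negP-correct (compile-correct φ ρ)) (negP-correct (compile-correct ψ ρ))))
  compile-correct (∀ᶠ φ) ρ = allP-correct (λ v → compile-correct φ (v ∷ ρ))
  compile-correct (∃ᶠ φ) ρ = decides-map
    (λ h → decidable-stable (sat? G (∃ᶠ φ) ρ) λ ¬ex → h λ v φv → ¬ex (v , φv))
    (λ (v , φv) h → h v φv)
    (negP-correct (allP-correct (λ v → negP-correct (compile-correct φ (v ∷ ρ)))))

-- Polynomial bounds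

-- The base `suc n` is never 0, so its powers increase with the exponent for every `n`; `suc-^-≤`
-- returns to the base `n` at the end.
PolynomiallyBounded : (ℕ → ℕ) → Set
PolynomiallyBounded f = ∃[ c ] ∃[ d ] ∀ n → f n ≤ c * suc n ^ d

module _ where
  open ≤-Reasoning

  poly-const : ∀ k → PolynomiallyBounded (λ _ → k)
  poly-const k = k , 0 , λ _ → ≤-reflexive (sym (*-identityʳ k))

  poly-+ : ∀ {f g} → PolynomiallyBounded f → PolynomiallyBounded g → PolynomiallyBounded (λ n → f n + g n)
  poly-+ {f} {g} (c , d , f≤) (c′ , d′ , g≤) = c + c′ , d + d′ , λ n → begin
    f n + g n                                    ≤⟨ +-mono-≤ (f≤ n) (g≤ n) ⟩
    c * suc n ^ d + c′ * suc n ^ d′              ≤⟨ +-mono-≤ (*-monoʳ-≤ c (^-monoʳ-≤ (suc n) (m≤m+n d d′)))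
                                                             (*-monoʳ-≤ c′ (^-monoʳ-≤ (suc n) (m≤n+m d′ d))) ⟩
    c * suc n ^ (d + d′) + c′ * suc n ^ (d + d′) ≡⟨ *-distribʳ-+ (suc n ^ (d + d′)) c c′ ⟨
    (c + c′) * suc n ^ (d + d′)                  ∎

  poly-* : ∀ {f} → PolynomiallyBounded f → PolynomiallyBounded (λ n → n * f n)
  poly-* {f} (c , d , f≤) = c , suc d , λ n → begin
    n * f n                   ≤⟨ *-mono-≤ (n≤1+n n) (f≤ n) ⟩
    suc n * (c * suc n ^ d)   ≡⟨ *-assoc (suc n) c (suc n ^ d) ⟨
    suc n * c * suc n ^ d     ≡⟨ cong (_* suc n ^ d) (*-comm (suc n) c) ⟩
    c * suc n * suc n ^ d     ≡⟨ *-assoc c (suc n) (suc n ^ d) ⟩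
    c * (suc n * suc n ^ d)   ∎

  ^-distribʳ-* : ∀ d m n → (m * n) ^ d ≡ m ^ d * n ^ d
  ^-distribʳ-* zero    m n = refl
  ^-distribʳ-* (suc d) m n = trans (cong (m * n *_) (^-distribʳ-* d m n))
    ([m*n]*[o*p]≡[m*o]*[n*p] m n (m ^ d) (n ^ d))

  -- For positive `n` the successor is at most `2 * n`; the summand 1 takes care of `n = 0`.
  suc-^-≤ : ∀ n d → suc n ^ d ≤ 2 ^ d * n ^ d + 1
  suc-^-≤ zero d = ≤-trans (≤-reflexive (^-zeroˡ d)) (m≤n+m 1 (2 ^ d * 0 ^ d))
  suc-^-≤ (suc n) d = begin
    suc (suc n) ^ d             ≤⟨ ^-monoˡ-≤ d (+-monoʳ-≤ 1 (m≤n+m (suc n) n)) ⟩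
    (suc n + suc n) ^ d         ≡⟨ cong (λ m → (suc n + m) ^ d) (+-identityʳ (suc n)) ⟨
    (2 * suc n) ^ d             ≡⟨ ^-distribʳ-* d 2 (suc n) ⟩
    2 ^ d * suc n ^ d           ≤⟨ m≤m+n _ 1 ⟩
    2 ^ d * suc n ^ d + 1       ∎

poly-neg : ∀ {f} → PolynomiallyBounded f → PolynomiallyBounded (λ n → negT (f n))
poly-neg p = poly-+ p (poly-const 2)

poly-and : ∀ {f g} → PolynomiallyBounded f → PolynomiallyBounded g →
  PolynomiallyBounded (λ n → andT (f n) (g n))
poly-and p q = poly-+ p (poly-+ (poly-const 2) q)

poly-all : ∀ {f} → PolynomiallyBounded f → PolynomiallyBounded (λ n → allT n (f n))
poly-all p = poly-+ (poly-const 5) (poly-* (poly-+ (poly-const 6) p))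

time-poly : ∀ {k} (φ : Formula k) → PolynomiallyBounded (time φ)
time-poly (edgeᶠ _ _) = poly-const 1
time-poly (sameᶠ _ _) = poly-const 5
time-poly (¬ᶠ φ)    = poly-neg (time-poly φ)
time-poly (φ ∧ᶠ ψ)  = poly-and (time-poly φ) (time-poly ψ)
time-poly (φ ∨ᶠ ψ)   = poly-neg (poly-and (poly-neg (time-poly φ)) (poly-neg (time-poly ψ)))
time-poly (∀ᶠ φ)    = poly-all (time-poly φ)
time-poly (∃ᶠ φ)     = poly-neg (poly-all (poly-neg (time-poly φ)))

definable⇒recognizable : ∀ {P : ∀ {n} → Graph (Fin n) → Set} (φ : Formula 0) →
  (∀ {n} (G : Graph (Fin n)) → Sat G φ [] ⇔ P G) → RecognizableInPolynomialTime P
definable⇒recognizable {P} φ φ⇔P with time-poly φ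
... | c , d , time≤ = p , C , d , recognizes
  where
  p : Program
  p = compile φ ⨾ instr (const 2 0) ⨾ instr (add 0 1 2)

  C : ℕ
  -- One constant serves as coefficient and as additive term; the 2 pays for moving the verdict from
  -- cell 1 to cell 0.
  C = c * 2 ^ d + (c + 2)

  bound : ∀ n {t} → t ≤ time φ n → t + 2 ≤ C * n ^ d + C
  bound n {t} t≤ = begin
    t + 2                                  ≤⟨ +-monoˡ-≤ 2 (≤-trans t≤ (time≤ n)) ⟩
    c * suc n ^ d + 2                      ≤⟨ +-monoˡ-≤ 2 (*-monoʳ-≤ c (suc-^-≤ n d)) ⟩
    c * (2 ^ d * n ^ d + 1) + 2            ≡⟨ cong (_+ 2) (*-distribˡ-+ c (2 ^ d * n ^ d) 1) ⟩
    c * (2 ^ d * n ^ d) + c * 1 + 2        ≡⟨ +-assoc (c * (2 ^ d * n ^ d)) (c * 1) 2 ⟩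
    c * (2 ^ d * n ^ d) + (c * 1 + 2)      ≡⟨ cong₂ (λ a b → a + (b + 2)) (sym (*-assoc c (2 ^ d) (n ^ d))) (*-identityʳ c) ⟩
    c * 2 ^ d * n ^ d + (c + 2)            ≤⟨ +-mono-≤ (*-monoˡ-≤ (n ^ d) (m≤m+n (c * 2 ^ d) (c + 2)))
                                                       (m≤n+m (c + 2) (c * 2 ^ d)) ⟩
    C * n ^ d + C                          ∎
    where open ≤-Reasoning

  accepts : ∀ {r A B} → Verdict r A → A ⇔ B → r + 0 ≡ 1 ⇔ B
  accepts (inj₁ (refl , a)) A⇔B = mk⇔ (λ _ → Equivalence.to A⇔B a) (λ _ → refl)
  accepts (inj₂ (refl , ¬a)) A⇔B = mk⇔ (λ ()) (λ b → contradiction (Equivalence.from A⇔B b) ¬a)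

  recognizes : ∀ {n} (G : Graph (Fin n)) →
    ∃[ t ] ∃[ M ] (Runs G p (initial n) t M × t ≤ C * n ^ d + C × (M 0 ≡ 1 ⇔ P G))
  recognizes {n} G with compile-correct G φ [] (initial n) (env refl λ ())
  ... | result run t≤ _ v = _ , _ , seq run (seq instr instr) , bound n t≤ , accepts v (φ⇔P G)

-- First-order definition of the cubic localizable graphs

threeNeighboursᶠ : ∀ {k} → Fin k → Fin k → Fin k → Fin k → Formula k
threeNeighboursᶠ v a b c =
  ¬ᶠ sameᶠ a b ∧ᶠ ¬ᶠ sameᶠ a c ∧ᶠ ¬ᶠ sameᶠ b c ∧ᶠ edgeᶠ v a ∧ᶠ edgeᶠ v b ∧ᶠ edgeᶠ v c

-- Under all quantifiers the indices `4F`, ..., `0F` stand for the vertex, its three neighbours and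
-- a further vertex; the implication is expressed as a disjunction.
cubicᶠ : Formula 0
cubicᶠ = ∀ᶠ (∃ᶠ (∃ᶠ (∃ᶠ (threeNeighboursᶠ 3F 2F 1F 0F ∧ᶠ
  ∀ᶠ (¬ᶠ edgeᶠ 4F 0F ∨ᶠ sameᶠ 0F 3F ∨ᶠ sameᶠ 0F 2F ∨ᶠ sameᶠ 0F 1F)))))

-- In the scope of the quantifiers, the indices 5F, …, 0F stand for v, u, a₁, a₂, b₁, b₂.
strongEdgeᶠ : Formula 1
strongEdgeᶠ = ∃ᶠ (∃ᶠ (∃ᶠ (∃ᶠ (∃ᶠ (threeNeighboursᶠ 5F 4F 3F 2F ∧ᶠ threeNeighboursᶠ 4F 5F 1F 0F ∧ᶠ
  edgeᶠ 3F 1F ∧ᶠ edgeᶠ 3F 0F ∧ᶠ edgeᶠ 2F 1F ∧ᶠ edgeᶠ 2F 0F)))))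

-- Here the indices 5F, …, 0F stand for v, b, c, p, q, r.
strongTriangleᶠ : Formula 1
strongTriangleᶠ = ∃ᶠ (∃ᶠ (∃ᶠ (∃ᶠ (∃ᶠ (threeNeighboursᶠ 5F 4F 3F 2F ∧ᶠ threeNeighboursᶠ 4F 5F 3F 1F ∧ᶠ
  threeNeighboursᶠ 3F 5F 4F 0F ∧ᶠ (edgeᶠ 2F 1F ∨ᶠ edgeᶠ 2F 0F ∨ᶠ edgeᶠ 1F 0F))))))

tetrahedronᶠ : Formula 1
tetrahedronᶠ = ∃ᶠ (∃ᶠ (∃ᶠ (threeNeighboursᶠ 3F 2F 1F 0F ∧ᶠ edgeᶠ 2F 1F ∧ᶠ edgeᶠ 2F 0F ∧ᶠ edgeᶠ 1F 0F)))

locallyStrongᶠ : Formula 1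
locallyStrongᶠ = strongEdgeᶠ ∨ᶠ strongTriangleᶠ ∨ᶠ tetrahedronᶠ

cubicLocalizableᶠ : Formula 0
cubicLocalizableᶠ = cubicᶠ ∧ᶠ ∀ᶠ locallyStrongᶠ

module _ {n : ℕ} (G : Graph (Fin n)) where
  open Graph G

  private
    Distinct×Adjacent : Fin n → Fin n → Fin n → Fin n → Set
    Distinct×Adjacent v a b c = a ≢ b × a ≢ c × b ≢ c × Adj v a × Adj v b × Adj v c

    fold : ∀ {v a b c} → Distinct×Adjacent v a b c → ThreeNeighbours G v a b c
    fold (ab , ac , bc , a , b , c) = threeNeighbours ab ac bc a b c

    unfold : ∀ {v a b c} → ThreeNeighbours G v a b c → Distinct×Adjacent v a b c
    unfold (threeNeighbours ab ac bc a b c) = ab , ac , bc , a , b , c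

  cubic⇒sat : Cubic G → Sat G cubicᶠ []
  cubic⇒sat cubic v with CubicGraph.allNeighbours G cubic v
  ... | a , b , c , t = a , b , c , unfold t , covers
    where
    covers : ∀ w → ¬ Adj v w ⊎ w ≡ a ⊎ w ≡ b ⊎ w ≡ c
    covers w with _~?_ G v w
    ... | yes v~w = inj₂ (CubicGraph.neighbours G cubic t v~w)
    ... | no v≁w = inj₁ v≁w

  sat⇒cubic : Sat G cubicᶠ [] → Cubic G
  sat⇒cubic sat v with sat v
  ... | a , b , c , t , covers = complete⇒degree≡3 G (fold t) λ w v~w →
        [ (λ v≁w → contradiction v~w v≁w) , id ]′ (covers w)

  locallyStrong⇒sat : ∀ {v} → LocallyStrong G v →
    Sat G (locallyStrongᶠ) (v ∷ [])
  locallyStrong⇒sat (inj₁ (u , strongEdge t s e₁₁ e₁₂ e₂₁ e₂₂)) =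
    inj₁ (u , _ , _ , _ , _ , unfold t , unfold s , e₁₁ , e₁₂ , e₂₁ , e₂₂)
  locallyStrong⇒sat (inj₂ (inj₁ (b , c , strongTriangle t s r linked))) =
    inj₂ (inj₁ (b , c , _ , _ , _ , unfold t , unfold s , unfold r , linked))
  locallyStrong⇒sat (inj₂ (inj₂ (a , b , c , tetrahedron t ab ac bc))) =
    inj₂ (inj₂ (a , b , c , unfold t , ab , ac , bc))

  sat⇒locallyStrong : ∀ {v} → Sat G (locallyStrongᶠ) (v ∷ []) →
    LocallyStrong G v
  sat⇒locallyStrong (inj₁ (u , _ , _ , _ , _ , t , s , e₁₁ , e₁₂ , e₂₁ , e₂₂)) =
    inj₁ (u , strongEdge (fold t) (fold s) e₁₁ e₁₂ e₂₁ e₂₂)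
  sat⇒locallyStrong (inj₂ (inj₁ (b , c , _ , _ , _ , t , s , r , linked))) =
    inj₂ (inj₁ (b , c , strongTriangle (fold t) (fold s) (fold r) linked))
  sat⇒locallyStrong (inj₂ (inj₂ (a , b , c , t , ab , ac , bc))) =
    inj₂ (inj₂ (a , b , c , tetrahedron (fold t) ab ac bc))

  cubicLocalizable-definable : Sat G cubicLocalizableᶠ [] ⇔ (Cubic G × Localizable G)
  cubicLocalizable-definable = mk⇔
    (λ (satCubic , satLocal) → let cubic = sat⇒cubic satCubic in
      cubic , LocallyStrongGraph.localizable G cubic (sat⇒locallyStrong ∘ satLocal))
    (λ (cubic , loc) → cubic⇒sat cubic , λ v → locallyStrong⇒sat
      (everyVertexInStrongClique⇒locallyStrong G cubic (localizable⇒everyVertexInStrongClique G loc) v))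

mainTheorem12 : (∀ {n} (G : Graph (Fin n)) → Connected G → Cubic G →
    (Localizable G ⇔ EveryVertexInStrongClique G) ×
    (EveryVertexInStrongClique G ⇔
    (G ≅ K₃,₃ ⊎ G ≅ K₄ ⊎ G ≅ C₆-complement ⊎ (∃[ m ] (2 ≤ m × G ≅ F m))))) ×
    RecognizableInPolynomialTime (λ G → Cubic G × Localizable G)
mainTheorem12 =
  (λ G connected cubic →
    mk⇔ (localizable⇒everyVertexInStrongClique G)
        (LocallyStrongGraph.localizable G cubic ∘ everyVertexInStrongClique⇒locallyStrong G cubic) ,
    mk⇔ (locallyStrong⇒listed G connected cubic ∘ everyVertexInStrongClique⇒locallyStrong G cubic)
        (λ listed v → Strong.locallyStrong⇒strongClique G cubic
          (listed⇒locallyStrong listed v))) ,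
  definable⇒recognizable cubicLocalizableᶠ cubicLocalizable-definable
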